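{- Let $\alpha>1$ be a real number. Then there exist an uncountable set $C$ of irrational numbers in $(0,1)$ and a set $\Xi_\alpha\subset(0,\infty)$ of cardinality $2^{\aleph_0}$ such that \[ C\ \subseteq\ \operatorname{sp}\bigl((\xi\alpha^n)_{n\ge1}\bigr)\qquad\text{for every }\xi\in\Xi_\alpha . \] In particular, the spectrum $\operatorname{sp}\bigl((\xi\alpha^n)_{n\ge1}\bigr)$ is uncountable for every $\xi\in\Xi_\alpha$, and so the assertion "for every non-zero real number $\xi$ and every real number $\alpha>1$, the spectrum of the sequence $(\xi\alpha^n)_{n\ge1}$ is at most countable" is false.
   Context: For a real number $t$, $\{t\}$ denotes its fractional part. A sequence $(x_n)_{n\ge1}$ of real numbers is uniformly distributed modulo one (u.d. mod 1) if \[ \frac1N\,\#\bigl\{1\le n\le N:\{x_n\}\in[a,b)\bigr\}\longrightarrow b-a\qquad(N\to\infty) \] for all $0\le a<b\le1$. The spectrum of a sequence $(x_n)_{n\ge1}$ of real numbers is \[ \operatorname{sp}\bigl((x_n)_{n\ge1}\bigr)=\bigl\{\theta\in(0,1)\setminus\mathbb{Q}:\ (x_n-n\theta)_{n\ge1}\ \text{is not u.d. mod }1\bigr\}. \] -}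

module Defs where

open import Data.Bool.Base using (Bool)
open import Data.Fin.Base using (toℕ)
open import Data.Fin.Subset using (Subset; _∈_; ∣_∣)
open import Data.Integer.Base using (ℤ; +_)
open import Data.Nat.Base as ℕ using (ℕ; zero; suc)
import Data.Nat.Properties as ℕ
open import Data.Product.Base using (_×_; _,_; ∃; ∃-syntax; Σ-syntax; proj₁)
open import Data.Rational.Base as ℚ using (ℚ; 0ℚ; 1ℚ; ½)
import Data.Rational.Properties as ℚ
open import Data.Rational.Solver using (module +-*-Solver)
open import Function.Bundles using (Bijection; _⇔_)
open import Level using (0ℓ)
open import Relation.Binary.Bundles using (Setoid)
import Relation.Binary.Construct.On as On
open import Relation.Binary.PropositionalEquality
  using (_≡_; refl; sym; trans; cong; subst; _→-setoid_)
open import Relation.Nullary.Negation.Core using (¬_)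
open import Relation.Unary using (Pred)

------------------------------------------------------------------------
-- Real numbers: Cauchy sequences of rationals, taken up to _≈_.  The
-- modulus is part of the data.  A set of reals is a predicate on ℝ
-- respecting _≈_.

Cauchy : (ℕ → ℚ) → Set
Cauchy x = ∀ ε → 0ℚ ℚ.< ε →
  ∃[ N ] (∀ m n → N ℕ.≤ m → N ℕ.≤ n → ℚ.∣ x m ℚ.- x n ∣ ℚ.< ε)

record ℝ : Set where
  constructor mkℝ
  field
    seq    : ℕ → ℚ
    cauchy : Cauchy seq

open ℝ public

infix 4 _≈_ _<ℝ_ _≤ℝ_

_≈_ : ℝ → ℝ → Set
x ≈ y = ∀ ε → 0ℚ ℚ.< ε →
  ∃[ N ] (∀ n → N ℕ.≤ n → ℚ.∣ seq x n ℚ.- seq y n ∣ ℚ.< ε)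

_<ℝ_ : ℝ → ℝ → Set
x <ℝ y = ∃[ δ ] (0ℚ ℚ.< δ ×
  ∃[ N ] (∀ n → N ℕ.≤ n → seq x n ℚ.+ δ ℚ.< seq y n))

_≤ℝ_ : ℝ → ℝ → Set
x ≤ℝ y = ¬ (y <ℝ x)

private
  half-pos : ∀ {ε} → 0ℚ ℚ.< ε → 0ℚ ℚ.< ½ ℚ.* ε
  half-pos {ε} p =
    subst (ℚ._< ½ ℚ.* ε) (ℚ.*-zeroʳ ½) (ℚ.*-monoʳ-<-pos ½ p)

  half+half : ∀ ε → ½ ℚ.* ε ℚ.+ ½ ℚ.* ε ≡ ε
  half+half ε =
    trans (sym (ℚ.*-distribʳ-+ ε ½ ½)) (ℚ.*-identityˡ ε)

  ∣p-p∣<ε : ∀ p {ε} → 0ℚ ℚ.< ε → ℚ.∣ p ℚ.- p ∣ ℚ.< ε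
  ∣p-p∣<ε p {ε} = subst (ℚ._< ε) (sym (cong ℚ.∣_∣ (ℚ.+-inverseʳ p)))

  ∣p-q∣≡∣q-p∣ : ∀ p q → ℚ.∣ p ℚ.- q ∣ ≡ ℚ.∣ q ℚ.- p ∣
  ∣p-q∣≡∣q-p∣ p q = trans (sym (ℚ.∣-p∣≡∣p∣ (p ℚ.- q))) (cong ℚ.∣_∣
    (solve 2 (λ p q → :- (p :- q) := q :- p) refl p q))
    where open +-*-Solver

  -- If r = p + q and |p|, |q| < ε/2, then |r| < ε.
  split : ∀ {r p q ε} → r ≡ p ℚ.+ q →
          ℚ.∣ p ∣ ℚ.< ½ ℚ.* ε → ℚ.∣ q ∣ ℚ.< ½ ℚ.* ε → ℚ.∣ r ∣ ℚ.< ε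
  split {p = p} {q} {ε} refl u v = subst (ℚ.∣ p ℚ.+ q ∣ ℚ.<_) (half+half ε)
    (ℚ.≤-<-trans (ℚ.∣p+q∣≤∣p∣+∣q∣ p q) (ℚ.+-mono-< u v))

  ⊔≤ˡ : ∀ m n {o} → m ℕ.⊔ n ℕ.≤ o → m ℕ.≤ o
  ⊔≤ˡ m n = ℕ.≤-trans (ℕ.m≤m⊔n m n)

  ⊔≤ʳ : ∀ m n {o} → m ℕ.⊔ n ℕ.≤ o → n ℕ.≤ o
  ⊔≤ʳ m n = ℕ.≤-trans (ℕ.m≤n⊔m m n)

≈-refl : ∀ {x} → x ≈ x
≈-refl {x} ε ε>0 = 0 , λ n _ → ∣p-p∣<ε (seq x n) ε>0

≈-sym : ∀ {x y} → x ≈ y → y ≈ x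
≈-sym {x} {y} p ε ε>0 with p ε ε>0
... | N , h = N , λ n N≤n →
  subst (ℚ._< ε) (∣p-q∣≡∣q-p∣ (seq x n) (seq y n)) (h n N≤n)

≈-trans : ∀ {x y z} → x ≈ y → y ≈ z → x ≈ z
≈-trans {x} {y} {z} p q ε ε>0
  with p (½ ℚ.* ε) (half-pos ε>0) | q (½ ℚ.* ε) (half-pos ε>0)
... | N , h | M , k = N ℕ.⊔ M , λ n l →
  split (solve 3 (λ x y z → x :- z := (x :- y) :+ (y :- z)) refl
           (seq x n) (seq y n) (seq z n))
        (h n (⊔≤ˡ N M l))
        (k n (⊔≤ʳ N M l))
  where open +-*-Solver

ℝ-setoid : Setoid 0ℓ 0ℓ
ℝ-setoid = record
  { Carrier = ℝ
  ; _≈_ = _≈_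
  ; isEquivalence = record
      { refl  = λ {x} → ≈-refl {x}
      ; sym   = λ {x} {y} → ≈-sym {x} {y}
      ; trans = λ {x} {y} {z} → ≈-trans {x} {y} {z}
      }
  }

fromℚ : ℚ → ℝ
fromℚ q = mkℝ (λ _ → q) (λ ε ε>0 → 0 , λ _ _ _ _ → ∣p-p∣<ε q ε>0)

fromℤ : ℤ → ℝ
fromℤ z = fromℚ (z ℚ./ 1)

fromℕ : ℕ → ℝ
fromℕ n = fromℤ (+ n)

0ℝ 1ℝ : ℝ
0ℝ = fromℚ 0ℚ
1ℝ = fromℚ 1ℚ

infixl 6 _+ℝ_ _-ℝ_
infixl 7 _*ℝ_
infixr 8 _^ℝ_
infix  8 -ℝ_

_+ℝ_ : ℝ → ℝ → ℝ
x +ℝ y = mkℝ (λ n → seq x n ℚ.+ seq y n) c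
  where
  open +-*-Solver
  c : Cauchy (λ n → seq x n ℚ.+ seq y n)
  c ε ε>0 with cauchy x (½ ℚ.* ε) (half-pos ε>0)
             | cauchy y (½ ℚ.* ε) (half-pos ε>0)
  ... | N , h | M , k = N ℕ.⊔ M , λ m n l l′ →
    split (solve 4 (λ a b c d → (a :+ b) :- (c :+ d) := (a :- c) :+ (b :- d))
             refl (seq x m) (seq y m) (seq x n) (seq y n))
          (h m n (⊔≤ˡ N M l) (⊔≤ˡ N M l′))
          (k m n (⊔≤ʳ N M l) (⊔≤ʳ N M l′))

-ℝ_ : ℝ → ℝ
-ℝ x = mkℝ (λ n → ℚ.- seq x n) c
  where
  open +-*-Solver
  c : Cauchy (λ n → ℚ.- seq x n)
  c ε ε>0 with cauchy x ε ε>0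
  ... | N , h = N , λ m n l l′ → subst (λ r → ℚ.∣ r ∣ ℚ.< ε)
    (solve 2 (λ a b → b :- a := (:- a) :- (:- b)) refl (seq x m) (seq x n))
    (h n m l′ l)

_-ℝ_ : ℝ → ℝ → ℝ
x -ℝ y = x +ℝ (-ℝ y)

private
  bounded : ∀ x → ∃[ B ] (ℚ.Positive B ×
            ∃[ N ] (∀ n → N ℕ.≤ n → ℚ.∣ seq x n ∣ ℚ.≤ B))
  bounded x with cauchy x 1ℚ (ℚ.positive⁻¹ 1ℚ)
  ... | N , h = B , B-pos , N , bound
    where
    open +-*-Solver
    p B : ℚ
    p = seq x N
    B = 1ℚ ℚ.+ ℚ.∣ p ∣
    B-pos : ℚ.Positive B
    B-pos = ℚ.positive (ℚ.+-mono-<-≤ (ℚ.positive⁻¹ 1ℚ) (ℚ.0≤∣p∣ p))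
    bound : ∀ n → N ℕ.≤ n → ℚ.∣ seq x n ∣ ℚ.≤ B
    bound n l = subst (λ r → ℚ.∣ r ∣ ℚ.≤ B)
      (solve 2 (λ a b → (a :- b) :+ b := a) refl (seq x n) p)
      (ℚ.≤-trans (ℚ.∣p+q∣≤∣p∣+∣q∣ (seq x n ℚ.- p) p)
        (ℚ.+-monoˡ-≤ ℚ.∣ p ∣ (ℚ.<⇒≤ (h n N l ℕ.≤-refl))))

  scale : ∀ B → ℚ.Positive B → ∀ ε → 0ℚ ℚ.< ε →
          ∃[ δ ] (0ℚ ℚ.< δ ×
            (∀ p d → ℚ.∣ p ∣ ℚ.≤ B → ℚ.∣ d ∣ ℚ.< δ → ℚ.∣ p ℚ.* d ∣ ℚ.< ε))
  scale B B-pos ε ε>0 = δ , δ>0 , small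
    where
    instance
      _ = B-pos
      _ = ℚ.pos⇒nonZero B
      _ = ℚ.1/pos⇒pos B
    δ : ℚ
    δ = ℚ.1/ B ℚ.* ε
    δ>0 : 0ℚ ℚ.< δ
    δ>0 = subst (ℚ._< δ) (ℚ.*-zeroʳ (ℚ.1/ B)) (ℚ.*-monoʳ-<-pos (ℚ.1/ B) ε>0)
    Bδ≡ε : B ℚ.* δ ≡ ε
    Bδ≡ε = trans (sym (ℚ.*-assoc B (ℚ.1/ B) ε))
      (trans (cong (ℚ._* ε) (ℚ.*-inverseʳ B)) (ℚ.*-identityˡ ε))
    small : ∀ p d → ℚ.∣ p ∣ ℚ.≤ B → ℚ.∣ d ∣ ℚ.< δ → ℚ.∣ p ℚ.* d ∣ ℚ.< ε
    small p d p≤B d<δ = begin-strict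
      ℚ.∣ p ℚ.* d ∣          ≡⟨ ℚ.∣p*q∣≡∣p∣*∣q∣ p d ⟩
      ℚ.∣ p ∣ ℚ.* ℚ.∣ d ∣    ≤⟨ ℚ.*-monoʳ-≤-nonNeg ℚ.∣ d ∣
                                  {{ℚ.nonNegative (ℚ.0≤∣p∣ d)}} p≤B ⟩
      B ℚ.* ℚ.∣ d ∣          <⟨ ℚ.*-monoʳ-<-pos B d<δ ⟩
      B ℚ.* δ                ≡⟨ Bδ≡ε ⟩
      ε                      ∎
      where open ℚ.≤-Reasoning

  *-cauchy : ∀ x y → Cauchy (λ n → seq x n ℚ.* seq y n)
  *-cauchy x y ε ε>0 =
    let A , A-pos , N₁ , x≤A = bounded x
        B , B-pos , N₂ , y≤B = bounded y
        δ , δ>0 , f = scale A A-pos (½ ℚ.* ε) (half-pos ε>0)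
        η , η>0 , g = scale B B-pos (½ ℚ.* ε) (half-pos ε>0)
        N₃ , h = cauchy y δ δ>0
        N₄ , k = cauchy x η η>0
        P = N₁ ℕ.⊔ N₂
        Q = N₃ ℕ.⊔ N₄
    in P ℕ.⊔ Q , λ m n l l′ →
      let q  = ⊔≤ʳ P Q l
          q′ = ⊔≤ʳ P Q l′
      in split
        (solve 4 (λ a b c d → a :* b :- c :* d := a :* (b :- d) :+ d :* (a :- c))
           refl (seq x m) (seq y m) (seq x n) (seq y n))
        (f (seq x m) (seq y m ℚ.- seq y n)
          (x≤A m (⊔≤ˡ N₁ N₂ (⊔≤ˡ P Q l)))
          (h m n (⊔≤ˡ N₃ N₄ q) (⊔≤ˡ N₃ N₄ q′)))
        (g (seq y n) (seq x m ℚ.- seq x n)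
          (y≤B n (⊔≤ʳ N₁ N₂ (⊔≤ˡ P Q l′)))
          (k m n (⊔≤ʳ N₃ N₄ q) (⊔≤ʳ N₃ N₄ q′)))
    where open +-*-Solver

_*ℝ_ : ℝ → ℝ → ℝ
x *ℝ y = mkℝ (λ n → seq x n ℚ.* seq y n) (*-cauchy x y)

_^ℝ_ : ℝ → ℕ → ℝ
x ^ℝ zero  = 1ℝ
x ^ℝ suc n = x *ℝ x ^ℝ n

------------------------------------------------------------------------
-- Uniform distribution and spectra

Irrational : Pred ℝ 0ℓ
Irrational x = ∀ q → ¬ (x ≈ fromℚ q)

-- s = {t}.  The floor z is not a computable function of t, so the
-- fractional part is a relation; s is unique up to _≈_.
IsFractionalPart : ℝ → ℝ → Set
IsFractionalPart t s = ∃[ z ] (s ≈ t -ℝ fromℤ z × 0ℝ ≤ℝ s × s <ℝ 1ℝ)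

-- {t} ∈ [a,b)
FracIn : ℝ → ℝ → ℝ → Set
FracIn a b t = ∃[ s ] (IsFractionalPart t s × a ≤ℝ s × s <ℝ b)

-- Sequences (xₙ)_{n≥1} are functions on ℕ whose value at 0 is ignored:
-- i : Fin N stands for the index n = toℕ i + 1.  The set
-- {1 ≤ n ≤ N : {xₙ} ∈ [a,b)} is not decidable, so its cardinality is
-- taken through the Subset having exactly its elements.  That Subset is
-- unique, and exists under excluded middle; UniformlyDistributedMod1 does
-- not assert that it exists, which can only make its negation stronger.
IsHitSet : (ℕ → ℝ) → ℝ → ℝ → (N : ℕ) → Subset N → Set
IsHitSet x a b N S = ∀ i → i ∈ S ⇔ FracIn a b (x (suc (toℕ i)))

∣_∣<_ : ℝ → ℝ → Set
∣ x ∣< ε = -ℝ ε <ℝ x × x <ℝ ε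

UniformlyDistributedMod1 : (ℕ → ℝ) → Set
UniformlyDistributedMod1 x =
  ∀ a b → 0ℝ ≤ℝ a → a <ℝ b → b ≤ℝ 1ℝ →
  ∀ ε → 0ℝ <ℝ ε →
  ∃[ N₀ ] (∀ N → .{{_ : ℕ.NonZero N}} → N₀ ℕ.≤ N →
    ∀ S → IsHitSet x a b N S →
    ∣ fromℚ (+ ∣ S ∣ ℚ./ N) -ℝ (b -ℝ a) ∣< ε)

sp : (ℕ → ℝ) → Pred ℝ 0ℓ
sp x θ = 0ℝ <ℝ θ × θ <ℝ 1ℝ × Irrational θ ×
  ¬ UniformlyDistributedMod1 (λ n → x n -ℝ fromℕ n *ℝ θ)

------------------------------------------------------------------------
-- Cardinality

-- Some sequence of reals runs through all elements of P (and possibly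
-- others, so that finite and empty sets are included).
AtMostCountable : Pred ℝ 0ℓ → Set
AtMostCountable P = Σ[ f ∈ (ℕ → ℝ) ] (∀ x → P x → ∃[ n ] (f n ≈ x))

Uncountable : Pred ℝ 0ℓ → Set
Uncountable P = ¬ AtMostCountable P

subsetSetoid : Pred ℝ 0ℓ → Setoid 0ℓ 0ℓ
subsetSetoid P = On.setoid {B = ∃ P} ℝ-setoid proj₁

HasCardinality2^ℵ₀ : Pred ℝ 0ℓ → Set
HasCardinality2^ℵ₀ P = Bijection (ℕ →-setoid Bool) (subsetSetoid P)

{-# OPTIONS --safe #-}
module Submission where

-- Fix m with αᵐ so large that, putting D = 40m, one has 2D ≤ αᵐ, and let cⱼ be a
-- rational approximation of α^(mj) with absolute error at most u = 1/D.  For any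
-- rational targets yⱼ a number ξ ∈ [1,2] with cⱼ ξ ∈ yⱼ + ℤ + [0,6u] for all
-- j ≥ 1 arises as an increasing limit of ξⱼ = wⱼ/cⱼ: take for wⱼ₊₁ one of the
-- first elements of yⱼ₊₁ + ℤ above ξⱼ cⱼ₊₁.  Choosing between two such elements at
-- every step gives a Cantor set Ξ of admissible ξ.
--
-- Let (rₜ) enumerate the rationals of [0,1), each infinitely often, and take
-- yⱼ = m j rₜ + 4u on the block 2ᵗ ≤ j < 2ᵗ⁺¹.  If θ is so close to rₜ that
-- n(θ − rₜ) is at most u in absolute value for n ≤ N = m 2ᵗ⁺¹, then {ξαⁿ − nθ} < 15u
-- for every n = m j of the block, hence for at least N/(2m) = 20uN of the n ≤ N.
-- The irrational θ which are this close to rₜ for infinitely many t thus lie in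
-- every spectrum; they form a dense G_δ set, uncountable by Baire category.

open import Defs
open import Data.Bool.Base using (Bool; true; false)
open import Data.Empty using (⊥; ⊥-elim)
open import Data.Fin.Base as Fin using (Fin)
import Data.Fin.Properties as Fin
open import Data.Fin.Subset using (Subset; inside; outside; _∈_)
import Data.Fin.Subset as Subset
import Data.Fin.Subset.Properties as Subset
open import Data.Integer.Base as ℤ using (ℤ; +_)
import Data.Integer.DivMod as ℤ
import Data.Integer.Properties as ℤ
open import Data.Nat.Base as ℕ using (ℕ; zero; suc)
open import Data.Nat.Logarithm using (⌊log₂_⌋; ⌊log₂⌊n/2⌋⌋≡⌊log₂n⌋∸1; ⌊log₂⌋-mono-≤)
import Data.Nat.Properties as ℕ
open import Data.Product.Base using (_×_; _,_; ∃-syntax; Σ-syntax; proj₁; proj₂)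
open import Data.Rational.Base
  using (ℚ; mkℚ; 0ℚ; 1ℚ; ½; _+_; _*_; _-_; -_; _/_; 1/_; _≤_; _<_; floor; toℚᵘ)
import Data.Rational.Base as ℚ
open import Data.Rational.Properties as ℚ using (≤-trans; <-≤-trans; ≤-<-trans; <⇒≤)
open import Data.Rational.Solver using (module +-*-Solver)
open import Data.Rational.Unnormalised.Base as ℚᵘ using (mkℚᵘ; *≡*; *≤*; *<*)
import Data.Rational.Unnormalised.Properties as ℚᵘ
open import Data.Sum.Base as Sum using (_⊎_; inj₁; inj₂)
open import Data.Vec.Base using (_∷_; []; here; there)
open import Function.Base using (_∘_)
open import Function.Bundles using (module Bijection; _⇔_; mk⇔; Equivalence)
open import Function.Definitions using (Injective)
open import Level using (0ℓ)
open import Relation.Binary.Definitions using (_Respects_)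
open import Relation.Binary.PropositionalEquality
  using (_≡_; refl; sym; trans; cong; cong₂; subst; subst₂; module ≡-Reasoning; _≗_)
open import Relation.Nullary.Decidable.Core using (yes; no; from-yes; ¬¬-excluded-middle)
open import Relation.Nullary.Negation.Core using (¬_; contradiction)
open import Relation.Unary using (Pred; _⊆_)
open +-*-Solver using (solve; con; _:=_; _:+_; _:*_; _:-_; :-_)

-- Rational arithmetic

0≤+ : ∀ {p q} → 0ℚ ≤ p → 0ℚ ≤ q → 0ℚ ≤ p + q
0≤+ {p} {q} a b = subst (_≤ p + q) (ℚ.+-identityˡ 0ℚ) (ℚ.+-mono-≤ a b)

0<+ : ∀ {p q} → 0ℚ < p → 0ℚ ≤ q → 0ℚ < p + q
0<+ {p} {q} a b = subst (_< p + q) (ℚ.+-identityˡ 0ℚ) (ℚ.+-mono-<-≤ a b)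

0≤* : ∀ {p q} → 0ℚ ≤ p → 0ℚ ≤ q → 0ℚ ≤ p * q
0≤* {p} {q} a b = subst (_≤ p * q) (ℚ.*-zeroʳ p)
  (ℚ.*-monoˡ-≤-nonNeg p {{ℚ.nonNegative a}} b)

0<* : ∀ {p q} → 0ℚ < p → 0ℚ < q → 0ℚ < p * q
0<* {p} {q} a b = subst (_< p * q) (ℚ.*-zeroʳ p)
  (ℚ.*-monoʳ-<-pos p {{ℚ.positive a}} b)

p≤q⇒0≤q-p : ∀ {p q} → p ≤ q → 0ℚ ≤ q - p
p≤q⇒0≤q-p {p} {q} a = subst (_≤ q - p) (ℚ.+-inverseʳ p) (ℚ.+-monoˡ-≤ (- p) a)

p<q⇒0<q-p : ∀ {p q} → p < q → 0ℚ < q - p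
p<q⇒0<q-p {p} {q} a = subst (_< q - p) (ℚ.+-inverseʳ p) (ℚ.+-monoˡ-< (- p) a)

-- Linear (and polynomial) inequalities are proved by exhibiting the
-- difference of the two sides as a visibly nonnegative expression.
≤-by : ∀ {q p r} → q - p ≡ r → 0ℚ ≤ r → p ≤ q
≤-by {q} {p} refl a = subst₂ _≤_ (ℚ.+-identityˡ p)
  (solve 2 (λ q p → (q :- p) :+ p := q) refl q p) (ℚ.+-monoˡ-≤ p a)

<-by : ∀ {q p r} → q - p ≡ r → 0ℚ < r → p < q
<-by {q} {p} refl a = subst₂ _<_ (ℚ.+-identityˡ p)
  (solve 2 (λ q p → (q :- p) :+ p := q) refl q p) (ℚ.+-monoˡ-< p a)

*-monoʳ : ∀ {r p q} → 0ℚ ≤ r → p ≤ q → r * p ≤ r * q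
*-monoʳ {r} a = ℚ.*-monoˡ-≤-nonNeg r {{ℚ.nonNegative a}}

*-cancelˡ : ∀ {r p q} → 0ℚ < r → r * p ≤ r * q → p ≤ q
*-cancelˡ {r} a = ℚ.*-cancelˡ-≤-pos r {{ℚ.positive a}}

p≤∣p∣ : ∀ p → p ≤ ℚ.∣ p ∣
p≤∣p∣ p with ℚ.≤-total 0ℚ p
... | inj₁ a = ℚ.≤-reflexive (sym (ℚ.0≤p⇒∣p∣≡p a))
... | inj₂ a = ≤-trans a (ℚ.0≤∣p∣ p)

∣p∣<⇒p< : ∀ {p q} → ℚ.∣ p ∣ < q → p < q
∣p∣<⇒p< {p} = ≤-<-trans (p≤∣p∣ p)

∣p∣<⇒-q< : ∀ {p q} → ℚ.∣ p ∣ < q → - p < q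
∣p∣<⇒-q< {p} {q} a = ∣p∣<⇒p< (subst (_< q) (sym (ℚ.∣-p∣≡∣p∣ p)) a)

∣p∣< : ∀ {p q} → - p < q → p < q → ℚ.∣ p ∣ < q
∣p∣< {p} {q} a b with ℚ.∣p∣≡p∨∣p∣≡-p p
... | inj₁ e = subst (_< q) (sym e) b
... | inj₂ e = subst (_< q) (sym e) a

0<½* : ∀ {p} → 0ℚ < p → 0ℚ < ½ * p
0<½* = 0<* (ℚ.positive⁻¹ ½)

ι : ℕ → ℚ
ι n = + n / 1

toℚᵘ-/1 : ∀ z → toℚᵘ (z / 1) ℚᵘ.≃ mkℚᵘ z 0
toℚᵘ-/1 z = ℚ.toℚᵘ-fromℚᵘ (mkℚᵘ z 0)

/1-mono-≤ : ∀ {y z} → y ℤ.≤ z → y / 1 ≤ z / 1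
/1-mono-≤ {y} {z} a = ℚ.toℚᵘ-cancel-≤
  (ℚᵘ.≤-respˡ-≃ (ℚᵘ.≃-sym (toℚᵘ-/1 y)) (ℚᵘ.≤-respʳ-≃ (ℚᵘ.≃-sym (toℚᵘ-/1 z))
    (*≤* (subst₂ ℤ._≤_ (sym (ℤ.*-identityʳ y)) (sym (ℤ.*-identityʳ z)) a))))

/1-+ : ∀ y z → (y ℤ.+ z) / 1 ≡ y / 1 + z / 1
/1-+ y z = ℚ.toℚᵘ-injective (begin
  toℚᵘ ((y ℤ.+ z) / 1)             ≈⟨ toℚᵘ-/1 (y ℤ.+ z) ⟩
  mkℚᵘ (y ℤ.+ z) 0                 ≈⟨ *≡* (cong (ℤ._* + 1) (sym (cong₂ ℤ._+_ (ℤ.*-identityʳ y)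
      (ℤ.*-identityʳ z)))) ⟩
  mkℚᵘ y 0 ℚᵘ.+ mkℚᵘ z 0           ≈⟨ ℚᵘ.+-cong (toℚᵘ-/1 y) (toℚᵘ-/1 z) ⟨
  toℚᵘ (y / 1) ℚᵘ.+ toℚᵘ (z / 1)   ≈⟨ ℚ.toℚᵘ-homo-+ (y / 1) (z / 1) ⟨
  toℚᵘ (y / 1 + z / 1)             ∎)
  where open ℚᵘ.≃-Reasoning

ι-mono-≤ : ∀ {m n} → m ℕ.≤ n → ι m ≤ ι n
ι-mono-≤ a = /1-mono-≤ (ℤ.+≤+ a)

ι-+ : ∀ m n → ι (m ℕ.+ n) ≡ ι m + ι n
ι-+ m n = /1-+ (+ m) (+ n)

ι-suc : ∀ n → ι (suc n) ≡ ι n + 1ℚ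
ι-suc n = trans (ι-+ 1 n) (ℚ.+-comm 1ℚ (ι n))

ι-* : ∀ m n → ι (m ℕ.* n) ≡ ι m * ι n
ι-* zero    n = sym (ℚ.*-zeroˡ (ι n))
ι-* (suc m) n = begin
  ι (n ℕ.+ m ℕ.* n)      ≡⟨ ι-+ n (m ℕ.* n) ⟩
  ι n + ι (m ℕ.* n)      ≡⟨ cong (λ k → ι n + k) (ι-* m n) ⟩
  ι n + ι m * ι n        ≡⟨ solve 2 (λ n m → n :+ m :* n := (m :+ con 1ℚ) :* n) refl (ι n) (ι m) ⟩
  (ι m + 1ℚ) * ι n       ≡⟨ cong (_* ι n) (ι-suc m) ⟨
  ι (suc m) * ι n        ∎
  where open ≡-Reasoning

0≤ι : ∀ n → 0ℚ ≤ ι n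
0≤ι n = ι-mono-≤ {0} {n} ℕ.z≤n

0<ι : ∀ n → .{{ℕ.NonZero n}} → 0ℚ < ι n
0<ι n = <-≤-trans (ℚ.positive⁻¹ 1ℚ) (ι-mono-≤ {1} {n} (ℕ.>-nonZero⁻¹ n))

z/n*n≡z : ∀ z n .{{_ : ℕ.NonZero n}} → (z / n) * ι n ≡ z / 1
z/n*n≡z z n@(suc n-1) = ℚ.toℚᵘ-injective (begin
  toℚᵘ ((z / n) * ι n)             ≈⟨ ℚ.toℚᵘ-homo-* (z / n) (ι n) ⟩
  toℚᵘ (z / n) ℚᵘ.* toℚᵘ (ι n)     ≈⟨ ℚᵘ.*-cong (ℚ.toℚᵘ-fromℚᵘ (mkℚᵘ z n-1)) (toℚᵘ-/1 (+ n)) ⟩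
  mkℚᵘ z n-1 ℚᵘ.* mkℚᵘ (+ n) 0     ≈⟨ *≡*
      (trans (ℤ.*-identityʳ _) (cong (z ℤ.*_) (sym (ℤ.*-identityʳ (+ n))))) ⟩
  mkℚᵘ z 0                         ≈⟨ toℚᵘ-/1 z ⟨
  toℚᵘ (z / 1)                     ∎)
  where open ℚᵘ.≃-Reasoning

floor-≤ : ∀ p → floor p / 1 ≤ p
floor-≤ p@(mkℚ n d _) = ℚ.toℚᵘ-cancel-≤ (ℚᵘ.≤-respˡ-≃ (ℚᵘ.≃-sym (toℚᵘ-/1 (floor p)))
  (*≤* (subst (floor p ℤ.* + suc d ℤ.≤_) (sym (ℤ.*-identityʳ n)) (ℤ.[n/d]*d≤n n (+ suc d)))))

<-floor : ∀ p → p < floor p / 1 + 1ℚ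
<-floor p@(mkℚ n d _) = subst (p <_)
  (trans (cong (_/ 1) (ℤ.+-comm (+ 1) (floor p))) (/1-+ (floor p) (+ 1)))
  (ℚ.toℚᵘ-cancel-< (ℚᵘ.<-respʳ-≃ (ℚᵘ.≃-sym (toℚᵘ-/1 (ℤ.suc (floor p))))
  (*<* (subst (ℤ._< ℤ.suc (floor p) ℤ.* + suc d) (sym (ℤ.*-identityʳ n))
    (subst (λ z → n ℤ.< ℤ.suc z ℤ.* + suc d) (sym (ℤ.div-pos-is-/ℕ n (suc d))) (ℤ.n<s[n/ℕd]*d n
        (suc d)))))))

opaque
  ≤-ι : ∀ p → ∃[ n ] p ≤ ι n
  ≤-ι p = suc ℤ.∣ floor p ∣ , ≤-trans (<⇒≤ (<-floor p))
      (subst (floor p / 1 + 1ℚ ≤_) (sym (ι-suc ℤ.∣ floor p ∣))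
    (ℚ.+-monoˡ-≤ 1ℚ (/1-mono-≤ (i≤∣i∣ (floor p)))))
    where
    i≤∣i∣ : ∀ i → i ℤ.≤ + ℤ.∣ i ∣
    i≤∣i∣ (+ n)        = ℤ.≤-refl
    i≤∣i∣ (ℤ.-[1+ n ]) = ℤ.-≤+

opaque
  inverse : ∀ {p} → 0ℚ < p → ∃[ r ] (0ℚ < r × p * r ≡ 1ℚ)
  inverse {p} a = 1/ p , ℚ.positive⁻¹ (1/ p) {{ℚ.1/pos⇒pos p}} , ℚ.*-inverseʳ p
    where
    instance
      p-pos : ℚ.Positive p
      p-pos = ℚ.positive a
      p≢0 : ℚ.NonZero p
      p≢0 = ℚ.pos⇒nonZero p

opaque
  archimedean : ∀ {p} → 0ℚ < p → ∀ q → ∃[ n ] q ≤ ι n * p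
  archimedean {p} a q with inverse a
  ... | r , r>0 , pr≡1 with ≤-ι (q * r)
  ... | n , b = n , subst (_≤ ι n * p)
    (trans (solve 3 (λ p q r → p :* (q :* r) := q :* (p :* r)) refl p q r)
      (trans (cong (q *_) pr≡1) (ℚ.*-identityʳ q)))
    (subst (p * (q * r) ≤_) (ℚ.*-comm p (ι n)) (*-monoʳ (<⇒≤ a) b))

<⇒≱ : ∀ {p q} → p < q → ¬ (q ≤ p)
<⇒≱ p<q q≤p = ℚ.<-irrefl refl (<-≤-trans p<q q≤p)

-- Dyadic blocks, enumeration of the rationals, finite counting

-- Recovers the number of the dyadic block from an index in it. Halving `j` moves it down by one
-- block and lowers the logarithm by one.
⌊log₂⌋-unique : ∀ t {j} → 2 ℕ.^ t ℕ.≤ j → j ℕ.< 2 ℕ.^ suc t → ⌊log₂ j ⌋ ≡ t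
⌊log₂⌋-unique zero    {1} _ _ = refl
⌊log₂⌋-unique zero    {suc (suc j)} _ (ℕ.s≤s (ℕ.s≤s ()))
⌊log₂⌋-unique (suc t) {j} lower upper = begin
  ⌊log₂ j ⌋
      ≡⟨ ℕ.m+[n∸m]≡n {1} (⌊log₂⌋-mono-≤ (ℕ.≤-trans (ℕ.*-monoʳ-≤ 2 (ℕ.>-nonZero⁻¹ (2 ℕ.^ t)
      {{ℕ.m^n≢0 2 t}})) lower)) ⟨
  suc (⌊log₂ j ⌋ ℕ.∸ 1)       ≡⟨ cong suc (⌊log₂⌊n/2⌋⌋≡⌊log₂n⌋∸1 j) ⟨
  suc ⌊log₂ ℕ.⌊ j /2⌋ ⌋       ≡⟨ cong suc (⌊log₂⌋-unique t half-lower half-upper) ⟩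
  suc t                       ∎
  where
  open ≡-Reasoning
  double : ∀ n → ℕ.⌊ 2 ℕ.* n /2⌋ ≡ n
  double n = trans (cong (λ k → ℕ.⌊ n ℕ.+ k /2⌋) (ℕ.+-identityʳ n)) (sym (ℕ.n≡⌊n+n/2⌋ n))
  half-lower : 2 ℕ.^ t ℕ.≤ ℕ.⌊ j /2⌋
  half-lower = subst (ℕ._≤ ℕ.⌊ j /2⌋) (double (2 ℕ.^ t)) (ℕ.⌊n/2⌋-mono lower)
  half-upper : ℕ.⌊ j /2⌋ ℕ.< 2 ℕ.^ suc t
  -- From `j + 2 ≤ 2n + 1` with `n = 2 ^ suc t`, halving gives `⌊ j /2⌋ + 1 ≤ n`.
  half-upper = subst (suc ℕ.⌊ j /2⌋ ℕ.≤_) (trans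
    (cong (λ k → ℕ.⌈ n ℕ.+ k /2⌉) (ℕ.+-identityʳ n)) (sym (ℕ.n≡⌈n+n/2⌉ n)))
    (ℕ.⌊n/2⌋-mono (ℕ.s≤s upper))
    where n = 2 ℕ.^ suc t

-- Runs through the antidiagonals `a + b = s` one after another, each from `(0 , s)` to `(s , 0)`.
next : ℕ × ℕ → ℕ × ℕ
next (a , suc b) = suc a , b
next (a , zero)  = 0 , suc a

walk : ℕ → ℕ × ℕ
walk zero    = 0 , 0
walk (suc t) = next (walk t)

-- A pair `(0 , suc b)` follows the end `(b , 0)` of the preceding antidiagonal; any other follows
-- its neighbour on the same one. The bound `s ≤ t` makes fractions with large denominators occur
-- late.
walk-reaches : ∀ s a b → a ℕ.+ b ≡ s → ∃[ t ] (s ℕ.≤ t × walk t ≡ (a , b))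
walk-reaches zero    zero    zero    eq = 0 , ℕ.z≤n , refl
walk-reaches (suc s) zero    (suc b) eq with walk-reaches s b 0
    (trans (ℕ.+-identityʳ b) (ℕ.suc-injective eq))
... | t , s≤t , w = suc t , ℕ.s≤s s≤t , cong next w
walk-reaches s       (suc a) b       eq with walk-reaches s a (suc b) (trans (ℕ.+-suc a b) eq)
... | t , s≤t , w = suc t , ℕ.m≤n⇒m≤1+n s≤t , cong next w

-- The denominator exceeds the numerator by `suc b`, so the values lie in [0,1) and every pair of a
-- numerator and a larger denominator arises.
fraction : ℕ × ℕ → ℚ
fraction (a , b) = + a / suc (a ℕ.+ b)

-- Each rational of [0,1) occurs infinitely often, since fractions are not reduced.
rational : ℕ → ℚ
rational t = fraction (walk t)

opaque
  rational-surjective : ∀ {q} → 0ℚ ≤ q → q < 1ℚ → ∃[ t ] rational t ≡ q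
  rational-surjective {q@(mkℚ (+ a) d _)} 0≤q (ℚ.*<* q<1) =
    let t , _ , w = walk-reaches _ a (d ℕ.∸ a) refl
    in t , trans (cong fraction w) (trans (ℚ./-cong {p₁ = + a}
        refl (cong suc (ℕ.m+[n∸m]≡n a≤d))) (ℚ.↥p/↧p≡p q))
    where
    a≤d : a ℕ.≤ d
    a≤d = ℕ.s≤s⁻¹ (ℤ.drop‿+<+ (subst₂ ℤ._<_ (ℤ.*-identityʳ (+ a)) (ℤ.*-identityˡ (+ suc d)) q<1))
  rational-surjective {mkℚ (ℤ.-[1+ a ]) d _} (ℚ.*≤* ()) q<1

ι-cancel-< : ∀ {m n} → ι m < ι n → m ℕ.< n
ι-cancel-< {m} {n} a with m ℕ.<? n
... | yes m<n = m<n
... | no  m≮n = ⊥-elim (<⇒≱ a (ι-mono-≤ (ℕ.≮⇒≥ m≮n)))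

opaque
  -- Take `n > T` with `n (q - p) ≥ 2`. Then `a = floor (p n) + 1` lies strictly between `p n` and
  -- `q n`, and `a < n` because `q ≤ 1`. So a/n is an enumerated fraction, found at an index no
  -- smaller than `a + b = n - 1 ≥ T`.
  rational-dense : ∀ {p q} → 0ℚ ≤ p → p < q → q ≤ 1ℚ → ∀ T →
                   ∃[ t ] (T ℕ.≤ t × p < rational t × rational t < q)
  rational-dense {p} {q} 0≤p p<q q≤1 T =
    let t , a+b≤t , w = walk-reaches _ a b refl
    in t , ℕ.≤-trans (ℕ.s≤s⁻¹ (ℕ.≤-trans (ℕ.m≤n+m (suc T) k) (ℕ.≤-reflexive (sym 1+a+b≡n)))) a+b≤t ,
       subst (p <_) (sym (cong fraction w)) p<f , subst (_< q) (sym (cong fraction w)) f<q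
    where
    k n a b : ℕ
    k = proj₁ (archimedean (p<q⇒0<q-p p<q) (ι 2))
    n = k ℕ.+ suc T
    z : ℤ
    z = floor (p * ι n)
    a = suc ℤ.∣ z ∣
    b = n ℕ.∸ suc a
    instance
      n≢0 : ℕ.NonZero n
      n≢0 = ℕ.>-nonZero (ℕ.≤-trans (ℕ.s≤s ℕ.z≤n) (ℕ.m≤n+m (suc T) k))
    2≤n[q-p] : ι 2 ≤ ι n * (q - p)
    2≤n[q-p] = ≤-trans (proj₂ (archimedean (p<q⇒0<q-p p<q) (ι 2)))
      (ℚ.*-monoʳ-≤-nonNeg (q - p)
          {{ℚ.nonNegative (p≤q⇒0≤q-p (<⇒≤ p<q))}} (ι-mono-≤ (ℕ.m≤m+n k (suc T))))
    ∣z∣≡z : ∀ z → p * ι n < z / 1 + 1ℚ → + ℤ.∣ z ∣ ≡ z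
    ∣z∣≡z (+ z) _ = refl
    ∣z∣≡z (ℤ.-[1+ z ]) u = ⊥-elim (<⇒≱ u (≤-trans
      (ℚ.+-monoˡ-≤ 1ℚ (/1-mono-≤ {ℤ.-[1+ z ]} {ℤ.-[1+ 0 ]} (ℤ.-≤- ℕ.z≤n))) (0≤* 0≤p (0≤ι n))))
    ιa : ι a ≡ z / 1 + 1ℚ
    ιa = trans (ι-suc ℤ.∣ z ∣) (cong (λ z → z / 1 + 1ℚ) (∣z∣≡z z (<-floor (p * ι n))))
    pn<a : p * ι n < ι a
    pn<a = subst (p * ι n <_) (sym ιa) (<-floor (p * ι n))
    a<qn : ι a < q * ι n
    a<qn = subst (_< q * ι n) (sym ιa) (<-by
      {r = 1ℚ + ((ι n * (q - p) - ι 2) + (p * ι n - z / 1))}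
      (solve 4 (λ q n z p → q :* n :- (z :+ con 1ℚ) :=
          con 1ℚ :+ ((n :* (q :- p) :- con (ι 2)) :+ (p :* n :- z)))
        refl q (ι n) (z / 1) p)
      (0<+ (ℚ.positive⁻¹ 1ℚ) (0≤+ (p≤q⇒0≤q-p 2≤n[q-p]) (p≤q⇒0≤q-p (floor-≤ (p * ι n))))))
    a<n : a ℕ.< n
    a<n = ι-cancel-< (<-≤-trans a<qn (subst (q * ι n ≤_) (ℚ.*-identityˡ (ι n))
      (ℚ.*-monoʳ-≤-nonNeg (ι n) {{ℚ.nonNegative (0≤ι n)}} q≤1)))
    1+a+b≡n : suc (a ℕ.+ b) ≡ n
    1+a+b≡n = ℕ.m+[n∸m]≡n a<n
    fn≡a : fraction (a , b) * ι n ≡ ι a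
    fn≡a = trans (cong (_* ι n) (ℚ./-cong {p₁ = + a} {q₁ = suc (a ℕ.+ b)} {q₂ = n}
        refl 1+a+b≡n)) (z/n*n≡z (+ a) n)
    p<f : p < fraction (a , b)
    p<f = ℚ.*-cancelʳ-<-nonNeg (ι n) {{ℚ.nonNegative (0≤ι n)}} (subst (p * ι n <_) (sym fn≡a) pn<a)
    f<q : fraction (a , b) < q
    f<q = ℚ.*-cancelʳ-<-nonNeg (ι n) {{ℚ.nonNegative (0≤ι n)}} (subst (_< q * ι n) (sym fn≡a) a<qn)

-- Removing `f zero` makes `S` smaller but, by injectivity, keeps the other values.
injective⇒≤∣∣ : ∀ k {N} {S : Subset N} (f : Fin k → Fin N) → Injective _≡_ _≡_ f →
                (∀ i → f i ∈ S) → k ℕ.≤ Subset.∣ S ∣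
injective⇒≤∣∣ zero    f inj f∈S = ℕ.z≤n
injective⇒≤∣∣ (suc k) {S = S} f inj f∈S = ℕ.≤-trans
  (ℕ.s≤s (injective⇒≤∣∣ k (f ∘ Fin.suc) (Fin.suc-injective ∘ inj)
    (λ i → Subset.x∈p∧x≢y⇒x∈p-y (f∈S (Fin.suc i)) (λ e → Fin.0≢1+n (sym (inj e))))))
  (Subset.x∈p⇒∣p-x∣<∣p∣ (f∈S Fin.zero))

-- Excluded middle for one proposition is not refutable, hence neither is a decision of finitely
-- many. This suffices wherever the goal is absurdity.
¬¬-subset : ∀ N (P : Fin N → Set) → ¬ ¬ (∃[ S ] (∀ i → i ∈ S ⇔ P i))
¬¬-subset zero    P none = none ([] , λ ())
¬¬-subset (suc N) P none = ¬¬-subset N (P ∘ Fin.suc) λ (S , S⇔P) → ¬¬-excluded-middle λ where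
  (yes p) → none (inside ∷ S , λ where
    Fin.zero    → mk⇔ (λ _ → p) (λ _ → here)
    (Fin.suc i) → mk⇔ (λ i∈ → Equivalence.to (S⇔P i) (Subset.drop-there i∈))
                      (λ q → there (Equivalence.from (S⇔P i) q)))
  (no ¬p) → none (outside ∷ S , λ where
    Fin.zero    → mk⇔ (λ ()) (λ p → contradiction p ¬p)
    (Fin.suc i) → mk⇔ (λ i∈ → Equivalence.to (S⇔P i) (Subset.drop-there i∈))
                      (λ q → there (Equivalence.from (S⇔P i) q)))

-- Well-approximable numbers and Baire category

≈-<ℝ-trans : ∀ {x x′ y} → x ≈ x′ → x <ℝ y → x′ <ℝ y
≈-<ℝ-trans {x} {x′} {y} x≈x′ (δ , δ>0 , N , x<y) =
  ½ * δ , 0<½* δ>0 , N ℕ.+ M , λ n l → <-by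
    {r = (½ * δ - (seq x′ n - seq x n)) + (seq y n - (seq x n + δ))}
    (solve 4 (λ x x′ y δ → y :- (x′ :+ con ½ :* δ) := (con ½ :* δ :- (x′ :- x)) :+ (y :- (x :+ δ)))
      refl (seq x n) (seq x′ n) (seq y n) δ)
    (0<+ (p<q⇒0<q-p (∣p∣<⇒p< (close n (ℕ.m+n≤o⇒n≤o N l)))) (<⇒≤ (p<q⇒0<q-p (x<y n (ℕ.m+n≤o⇒m≤o N l)))))
  where
  M : ℕ
  M = proj₁ (≈-sym {x} {x′} x≈x′ (½ * δ) (0<½* δ>0))
  close : ∀ n → M ℕ.≤ n → ℚ.∣ seq x′ n - seq x n ∣ < ½ * δ
  close = proj₂ (≈-sym {x} {x′} x≈x′ (½ * δ) (0<½* δ>0))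

<ℝ-≈-trans : ∀ {x y y′} → x <ℝ y → y ≈ y′ → x <ℝ y′
<ℝ-≈-trans {x} {y} {y′} (δ , δ>0 , N , x<y) y≈y′ =
  ½ * δ , 0<½* δ>0 , N ℕ.+ M , λ n l → <-by
    {r = (½ * δ - (seq y n - seq y′ n)) + (seq y n - (seq x n + δ))}
    (solve 4 (λ x y y′ δ → y′ :- (x :+ con ½ :* δ) := (con ½ :* δ :- (y :- y′)) :+ (y :- (x :+ δ)))
      refl (seq x n) (seq y n) (seq y′ n) δ)
    (0<+ (p<q⇒0<q-p (∣p∣<⇒p< (close n (ℕ.m+n≤o⇒n≤o N l)))) (<⇒≤ (p<q⇒0<q-p (x<y n (ℕ.m+n≤o⇒m≤o N l)))))
  where
  M : ℕ
  M = proj₁ (y≈y′ (½ * δ) (0<½* δ>0))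
  close : ∀ n → M ℕ.≤ n → ℚ.∣ seq y n - seq y′ n ∣ < ½ * δ
  close = proj₂ (y≈y′ (½ * δ) (0<½* δ>0))

-- |θ − r| ≤ ρ
Within : ℚ → ℚ → ℝ → Set
Within r ρ θ = ∀ ε → 0ℚ < ε → ∃[ N ] (∀ n → N ℕ.≤ n → ℚ.∣ seq θ n - r ∣ < ρ + ε)

Within-resp-≈ : ∀ {r ρ} → Within r ρ Respects _≈_
Within-resp-≈ {r} {ρ} {θ} {θ′} θ≈θ′ near ε ε>0 = N ℕ.+ M , λ n l → begin-strict
  ℚ.∣ seq θ′ n - r ∣
    ≡⟨ cong ℚ.∣_∣ (solve 3 (λ θ θ′ r → θ′ :- r := (θ :- r) :+ (θ′ :- θ)) refl (seq θ n) (seq θ′ n) r) ⟩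
  ℚ.∣ (seq θ n - r) + (seq θ′ n - seq θ n) ∣
    ≤⟨ ℚ.∣p+q∣≤∣p∣+∣q∣ (seq θ n - r) (seq θ′ n - seq θ n) ⟩
  ℚ.∣ seq θ n - r ∣ + ℚ.∣ seq θ′ n - seq θ n ∣
    <⟨ ℚ.+-mono-< (proj₂ (near (½ * ε) (0<½* ε>0)) n (ℕ.m+n≤o⇒m≤o N l))
                  (proj₂ (θ′≈θ (½ * ε) (0<½* ε>0)) n (ℕ.m+n≤o⇒n≤o N l)) ⟩
  (ρ + ½ * ε) + ½ * ε
    ≡⟨ solve 2 (λ ρ ε → (ρ :+ con ½ :* ε) :+ con ½ :* ε := ρ :+ ε) refl ρ ε ⟩
  ρ + ε  ∎
  where
  open ℚ.≤-Reasoning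
  θ′≈θ : θ′ ≈ θ
  θ′≈θ = ≈-sym {θ} {θ′} θ≈θ′
  N M : ℕ
  N = proj₁ (near (½ * ε) (0<½* ε>0))
  M = proj₁ (θ′≈θ (½ * ε) (0<½* ε>0))

module _ (ρ : ℕ → ℚ) where

  WellApproximable : Pred ℝ 0ℓ
  WellApproximable θ = 0ℝ <ℝ θ × θ <ℝ 1ℝ × Irrational θ ×
    (∀ T → ∃[ t ] (T ℕ.≤ t × Within (rational t) (ρ t) θ))

  WellApproximable-resp-≈ : WellApproximable Respects _≈_
  WellApproximable-resp-≈ {θ} {θ′} θ≈θ′ (0<θ , θ<1 , irr , near) =
    <ℝ-≈-trans {0ℝ} {θ} {θ′} 0<θ θ≈θ′ , ≈-<ℝ-trans {θ} {θ′} {1ℝ} θ≈θ′ θ<1 ,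
    (λ q θ′≈q → irr q (≈-trans {θ} {θ′} {fromℚ q} θ≈θ′ θ′≈q)) ,
    λ T → let t , T≤t , near-t = near T in t , T≤t , Within-resp-≈ {rational t} {ρ t} {θ} {θ′} θ≈θ′
        near-t

record Interval : Set where
  constructor mkInterval
  field
    lo hi : ℚ
    0≤lo  : 0ℚ ≤ lo
    lo<hi : lo < hi
    hi≤1  : hi ≤ 1ℚ
open Interval

infix 4 _⊑_
_⊑_ : Interval → Interval → Set
J ⊑ I = lo I ≤ lo J × hi J ≤ hi I

⊑-trans : ∀ {I J K} → K ⊑ J → J ⊑ I → K ⊑ I
⊑-trans (a , b) (c , d) = ≤-trans c a , ≤-trans b d

-- The margin `η` separates `g` from the closed interval, so that limits of points of the interval
-- differ from `g` too.
Avoids : ℝ → Interval → Set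
Avoids g I = ∃[ η ] (0ℚ < η × ∃[ N ] (∀ n → N ℕ.≤ n → seq g n + η ≤ lo I ⊎ hi I + η ≤ seq g n))

opaque
  -- Approximate `g` by a rational `p` up to an eighth `w` of the length. If `p` is in the left half
  -- or further left, the last quarter of `I` stays at distance `w` from `g`; otherwise the first
  -- quarter does. Only rationals are compared.
  avoid : ∀ g I → ∃[ J ] (J ⊑ I × Avoids g J)
  avoid g I = by-side (ℚ.≤-total p (lo I + ι 4 * w))
    where
    w : ℚ
    w = + 1 / 8 * (hi I - lo I)
    w>0 : 0ℚ < w
    w>0 = 0<* (ℚ.positive⁻¹ (+ 1 / 8)) (p<q⇒0<q-p (lo<hi I))
    N : ℕ
    N = proj₁ (cauchy g w w>0)
    p : ℚ
    p = seq g N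
    close : ∀ n → N ℕ.≤ n → ℚ.∣ seq g n - p ∣ < w
    close n N≤n = proj₂ (cauchy g w w>0) n N N≤n ℕ.≤-refl
    hi≡ : hi I ≡ lo I + ι 8 * w
    hi≡ = solve 2 (λ h l → h := l :+ con (ι 8) :* (con (+ 1 / 8) :* (h :- l))) refl (hi I) (lo I)
    by-side : p ≤ lo I + ι 4 * w ⊎ lo I + ι 4 * w ≤ p → ∃[ J ] (J ⊑ I × Avoids g J)
    by-side (inj₁ p≤) =
      mkInterval (lo I + ι 6 * w) (hi I)
        (0≤+ (0≤lo I) (0≤* (0≤ι 6) (<⇒≤ w>0)))
        (subst (lo I + ι 6 * w <_) (sym hi≡) (ℚ.+-monoʳ-< (lo I)
          (ℚ.*-monoˡ-<-pos w {{ℚ.positive w>0}} {ι 6} {ι 8} (from-yes (ι 6 ℚ.<? ι 8))))) (hi≤1 I) ,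
      (≤-by (solve 2 (λ l w → (l :+ w) :- l :=
          w) refl (lo I) (ι 6 * w)) (0≤* (0≤ι 6) (<⇒≤ w>0)) , ℚ.≤-refl) ,
      w , w>0 , N , λ n N≤n → inj₁ (≤-by {r = (w - (seq g n - p)) + ((lo I + ι 4 * w) - p)}
        (solve 4 (λ l w g p → (l :+ con (ι 6) :* w) :- (g :+ w) :=
            (w :- (g :- p)) :+ ((l :+ con (ι 4) :* w) :- p))
          refl (lo I) w (seq g n) p)
        (0≤+ (<⇒≤ (p<q⇒0<q-p (∣p∣<⇒p< (close n N≤n)))) (p≤q⇒0≤q-p p≤)))
    by-side (inj₂ ≤p) =
      mkInterval (lo I) (lo I + ι 2 * w) (0≤lo I)
        (<-by (solve 2 (λ l w → (l :+ w) :- l := w) refl (lo I) (ι 2 * w)) (0<* (0<ι 2) w>0))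
        (≤-trans hi′≤hi (hi≤1 I)) ,
      (ℚ.≤-refl , hi′≤hi) ,
      w , w>0 , N , λ n N≤n → inj₂ (≤-by {r = (w - - (seq g n - p)) + (p - (lo I + ι 4 * w))}
        (solve 4 (λ l w g p → g :- ((l :+ con (ι 2) :* w) :+ w) :=
            (w :- (:- (g :- p))) :+ (p :- (l :+ con (ι 4) :* w)))
          refl (lo I) w (seq g n) p)
        (0≤+ (<⇒≤ (p<q⇒0<q-p (∣p∣<⇒-q< (close n N≤n)))) (p≤q⇒0≤q-p ≤p)))
      where
      hi′≤hi : lo I + ι 2 * w ≤ hi I
      hi′≤hi = subst (lo I + ι 2 * w ≤_) (sym hi≡) (≤-by
        (solve 2 (λ l w → (l :+ con (ι 8) :* w) :- (l :+ con (ι 2) :* w) :=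
            con (ι 6) :* w) refl (lo I) w)
        (0≤* (0≤ι 6) (<⇒≤ w>0)))

<-⊓ : ∀ {p q r} → r < p → r < q → r < p ℚ.⊓ q
<-⊓ {p} {q} {r} r<p r<q with ℚ.⊓-sel p q
... | inj₁ e = subst (r <_) (sym e) r<p
... | inj₂ e = subst (r <_) (sym e) r<q

module _ (ρ : ℕ → ℚ) (ρ>0 : ∀ t → 0ℚ < ρ t) (tρ≤1 : ∀ t → ι t * ρ t ≤ 1ℚ) where

  Shrunk : ℕ → Interval → Set
  Shrunk t J = rational t ≤ lo J × hi J ≤ rational t + ρ t

  opaque
    -- A one-sided neighbourhood is enough: a late rational inside `I` becomes the left end point,
    -- and the right end point is cut off at distance `ρ t`.
    shrink : ∀ T I → ∃[ J ] (J ⊑ I × ∃[ t ] (T ℕ.≤ t × Shrunk t J))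
    shrink T I = J , (<⇒≤ lo<r , ℚ.p⊓q≤p (hi I) (r + ρ t)) , t , T≤t , ℚ.≤-refl , ℚ.p⊓q≤q (hi I)
        (r + ρ t)
      where
      dense : ∃[ t ] (T ℕ.≤ t × lo I < rational t × rational t < hi I)
      dense = rational-dense (0≤lo I) (lo<hi I) (hi≤1 I) T
      t : ℕ
      t = proj₁ dense
      T≤t : T ℕ.≤ t
      T≤t = proj₁ (proj₂ dense)
      r : ℚ
      r = rational t
      lo<r : lo I < r
      lo<r = proj₁ (proj₂ (proj₂ dense))
      r<hi : r < hi I
      r<hi = proj₂ (proj₂ (proj₂ dense))
      r<r+ρ : r < r + ρ t
      r<r+ρ = <-by (solve 2 (λ r ρ → (r :+ ρ) :- r := ρ) refl r (ρ t)) (ρ>0 t)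
      J : Interval
      J = mkInterval r (hi I ℚ.⊓ (r + ρ t)) (≤-trans (0≤lo I) (<⇒≤ lo<r)) (<-⊓ r<hi r<r+ρ)
            (≤-trans (ℚ.p⊓q≤p (hi I) (r + ρ t)) (hi≤1 I))

  -- One step of the Baire category argument: two points are avoided and one dense open set is
  -- entered. The condition `k ≤ stage` yields both infinitely many approximations and lengths
  -- tending to 0.
  record Refinement (f : ℕ → ℝ) (k : ℕ) (I : Interval) : Set where
    field
      J               : Interval
      J⊑I             : J ⊑ I
      avoids-f        : Avoids (f k) J
      avoids-rational : Avoids (fromℚ (rational k)) J
      stage           : ℕ
      k≤stage         : k ℕ.≤ stage
      shrunk          : Shrunk stage J
  open Refinement

  Avoids-⊑ : ∀ g {I J} → J ⊑ I → Avoids g I → Avoids g J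
  Avoids-⊑ g (lo≤ , ≤hi) (η , η>0 , N , h) = η , η>0 , N , λ n l →
    Sum.map (λ e → ≤-trans e lo≤) (λ e → ≤-trans (ℚ.+-monoˡ-≤ η ≤hi) e) (h n l)

  opaque
    refine : ∀ f k I → Refinement f k I
    refine f k I =
      let J₁ , J₁⊑I , a₁ = avoid (f k) I
          J₂ , J₂⊑J₁ , a₂ = avoid (fromℚ (rational k)) J₁
          J₃ , J₃⊑J₂ , t , k≤t , near = shrink k J₂
          J₃⊑J₁ = ⊑-trans {J₁} {J₂} {J₃} J₃⊑J₂ J₂⊑J₁
      in record
        { J               = J₃
        ; J⊑I             = ⊑-trans {I} {J₁} {J₃} J₃⊑J₁ J₁⊑I
        ; avoids-f        = Avoids-⊑ (f k) {J₁} {J₃} J₃⊑J₁ a₁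
        ; avoids-rational = Avoids-⊑ (fromℚ (rational k)) {J₂} {J₃} J₃⊑J₂ a₂
        ; stage           = t
        ; k≤stage         = k≤t
        ; shrunk          = near
        }

  module Nested (f : ℕ → ℝ) where

    I : ℕ → Interval
    -- The distance from 0 and 1 gives `0 < θ < 1` with a margin.
    I zero    = mkInterval (+ 1 / 4) (+ 3 / 4) (ℚ.nonNegative⁻¹ (+ 1 / 4))
      (from-yes (+ 1 / 4 ℚ.<? + 3 / 4)) (from-yes (+ 3 / 4 ℚ.≤? 1ℚ))
    I (suc k) = J (refine f k (I k))

    refinement : ∀ k → Refinement f k (I k)
    refinement k = refine f k (I k)

    ⊑-+ : ∀ d k → I (d ℕ.+ k) ⊑ I k
    ⊑-+ zero    k = ℚ.≤-refl , ℚ.≤-refl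
    ⊑-+ (suc d) k = ⊑-trans {I k} {I (d ℕ.+ k)} {I (suc d ℕ.+ k)}
      (J⊑I (refinement (d ℕ.+ k))) (⊑-+ d k)

    I-⊑ : ∀ {k n} → k ℕ.≤ n → I n ⊑ I k
    I-⊑ {k} {n} k≤n = subst (λ n → I n ⊑ I k) (ℕ.m∸n+n≡m k≤n) (⊑-+ (n ℕ.∸ k) k)

    lo≤hi : ∀ {k n} → k ℕ.≤ n → lo (I n) ≤ hi (I k)
    lo≤hi {k} {n} k≤n = ≤-trans (<⇒≤ (lo<hi (I n))) (proj₂ (I-⊑ k≤n))

    -- After step `k` all left end points lie in an interval of length at most `ρ t` with `t ≥ k`,
    -- and `t ρ t ≤ 1`.
    θ-cauchy : Cauchy (λ n → lo (I n))
    θ-cauchy ε ε>0 = suc k , λ m n l l′ → ∣p∣<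
        (subst (_< ε) (solve 2 (λ m n → n :- m :=
            :- (m :- n)) refl (lo (I m)) (lo (I n))) (diff n m l′ l))
        (diff m n l l′)
      where
      k : ℕ
      -- The 2 makes the bound strict: `k ρ t ≤ 1 < 2 ≤ k ε`.
      k = proj₁ (archimedean ε>0 (ι 2))
      2≤kε : ι 2 ≤ ι k * ε
      2≤kε = proj₂ (archimedean ε>0 (ι 2))
      diff : ∀ m n → suc k ℕ.≤ m → suc k ℕ.≤ n → lo (I m) - lo (I n) < ε
      diff m n l l′ = ≤-<-trans
        (≤-by {r = (hi (I (suc k)) - lo (I m)) + (lo (I n) - lo (I (suc k))) + ((rational t + ρ t) - hi
            (I (suc k))) + (lo (I (suc k)) - rational t)}
          (solve 6 (λ m n h l r ρ → ρ :- (m :- n) :=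
              (h :- m) :+ (n :- l) :+ ((r :+ ρ) :- h) :+ (l :- r))
            refl (lo (I m)) (lo (I n)) (hi (I (suc k))) (lo (I (suc k))) (rational t) (ρ t))
          (0≤+ (0≤+ (0≤+ (p≤q⇒0≤q-p (lo≤hi l)) (p≤q⇒0≤q-p (proj₁ (I-⊑ l′))))
            (p≤q⇒0≤q-p (proj₂ (shrunk (refinement k))))) (p≤q⇒0≤q-p (proj₁ (shrunk (refinement k))))))
        (ℚ.*-cancelˡ-<-nonNeg (ι k) {{ℚ.nonNegative (0≤ι k)}} (begin-strict
          ι k * ρ t  ≤⟨ ℚ.*-monoʳ-≤-nonNeg (ρ t)
              {{ℚ.nonNegative (<⇒≤ (ρ>0 t))}} (ι-mono-≤ {k} {t} (k≤stage (refinement k))) ⟩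
          ι t * ρ t  ≤⟨ tρ≤1 t ⟩
          1ℚ         <⟨ from-yes (1ℚ ℚ.<? ι 2) ⟩
          ι 2        ≤⟨ 2≤kε ⟩
          ι k * ε    ∎))
        where
        open ℚ.≤-Reasoning
        t = stage (refinement k)

    θ : ℝ
    θ = mkℝ (λ n → lo (I n)) θ-cauchy

    avoids⇒≉ : ∀ g k → Avoids g (I k) → ¬ (θ ≈ g)
    avoids⇒≉ g k (η , η>0 , N , h) θ≈g = absurd (h n (ℕ.≤-trans (ℕ.m≤n+m N M) (ℕ.m≤m+n (M ℕ.+ N) k)))
      where
      M : ℕ
      M = proj₁ (θ≈g η η>0)
      n : ℕ
      n = M ℕ.+ N ℕ.+ k
      close : ℚ.∣ lo (I n) - seq g n ∣ < η
      close = proj₂ (θ≈g η η>0) n (ℕ.≤-trans (ℕ.m≤m+n M N) (ℕ.m≤m+n (M ℕ.+ N) k))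
      k≤n : k ℕ.≤ n
      k≤n = ℕ.m≤n+m k (M ℕ.+ N)
      absurd : seq g n + η ≤ lo (I k) ⊎ hi (I k) + η ≤ seq g n → ⊥
      absurd (inj₁ e) = <⇒≱ (∣p∣<⇒p< close)
          (≤-by {r = (lo (I n) - lo (I k)) + (lo (I k) - (seq g n + η))}
        (solve 4 (λ a g η l → (a :- g) :- η :=
            (a :- l) :+ (l :- (g :+ η))) refl (lo (I n)) (seq g n) η (lo (I k)))
        (0≤+ (p≤q⇒0≤q-p (proj₁ (I-⊑ k≤n))) (p≤q⇒0≤q-p e)))
      absurd (inj₂ e) = <⇒≱ (∣p∣<⇒-q< close)
          (≤-by {r = (hi (I k) - lo (I n)) + (seq g n - (hi (I k) + η))}
        (solve 4 (λ a g η h → (:- (a :- g)) :- η :=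
            (h :- a) :+ (g :- (h :+ η))) refl (lo (I n)) (seq g n) η (hi (I k)))
        (0≤+ (p≤q⇒0≤q-p (lo≤hi k≤n)) (p≤q⇒0≤q-p e)))

    θ≉f : ∀ k → ¬ (θ ≈ f k)
    θ≉f k = avoids⇒≉ (f k) (suc k) (avoids-f (refinement k))

    -- Only the rationals of [0,1) are enumerated and avoided. One equal to `θ` would be among them,
    -- as `θ` stays in [1/4, 3/4].
    θ-irrational : Irrational θ
    θ-irrational q θ≈q = avoids⇒≉ (fromℚ q) (suc k)
      (subst (λ q → Avoids (fromℚ q) (I (suc k))) r≡q (avoids-rational (refinement k)))
      θ≈q
      where
      N : ℕ
      N = proj₁ (θ≈q (+ 1 / 4) (ℚ.positive⁻¹ (+ 1 / 4)))
      close : ℚ.∣ lo (I N) - q ∣ < + 1 / 4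
      close = proj₂ (θ≈q (+ 1 / 4) (ℚ.positive⁻¹ (+ 1 / 4))) N ℕ.≤-refl
      0≤q : 0ℚ ≤ q
      0≤q = ≤-by {r = (+ 1 / 4 - (lo (I N) - q)) + (lo (I N) - + 1 / 4)}
        (solve 2 (λ q l → q :- con 0ℚ :=
            (con (+ 1 / 4) :- (l :- q)) :+ (l :- con (+ 1 / 4))) refl q (lo (I N)))
        (0≤+ (<⇒≤ (p<q⇒0<q-p (∣p∣<⇒p< close))) (p≤q⇒0≤q-p (proj₁ (I-⊑ {0} {N} ℕ.z≤n))))
      q<1 : q < 1ℚ
      q<1 = <-by {r = (+ 1 / 4 - - (lo (I N) - q)) + (+ 3 / 4 - lo (I N))}
        (solve 2 (λ q l → con 1ℚ :- q :=
            (con (+ 1 / 4) :- (:- (l :- q))) :+ (con (+ 3 / 4) :- l)) refl q (lo (I N)))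
        (0<+ (p<q⇒0<q-p (∣p∣<⇒-q< close)) (p≤q⇒0≤q-p (lo≤hi {0} {N} ℕ.z≤n)))
      k : ℕ
      k = proj₁ (rational-surjective 0≤q q<1)
      r≡q : rational k ≡ q
      r≡q = proj₂ (rational-surjective 0≤q q<1)

    θ-near : ∀ k → Within (rational (stage (refinement k))) (ρ (stage (refinement k))) θ
    θ-near k ε ε>0 = suc k , λ n l → ∣p∣<
      (≤-<-trans (≤-trans
        (≤-by (solve 2 (λ l r → con 0ℚ :- (:- (l :- r)) := l :- r) refl (lo (I n)) r)
          (p≤q⇒0≤q-p (≤-trans (proj₁ (shrunk (refinement k))) (proj₁ (I-⊑ l)))))
        (<⇒≤ (ρ>0 t))) ρ<ρ+ε)
      (≤-<-trans
        (≤-by {r = (hi (I (suc k)) - lo (I n)) + ((r + ρ t) - hi (I (suc k)))}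
          (solve 4 (λ l r ρ h → ρ :- (l :- r) :=
              (h :- l) :+ ((r :+ ρ) :- h)) refl (lo (I n)) r (ρ t) (hi (I (suc k))))
          (0≤+ (p≤q⇒0≤q-p (lo≤hi l)) (p≤q⇒0≤q-p (proj₂ (shrunk (refinement k)))))) ρ<ρ+ε)
      where
      t = stage (refinement k)
      r = rational t
      ρ<ρ+ε : ρ t < ρ t + ε
      ρ<ρ+ε = <-by (solve 2 (λ r ρ → (r :+ ρ) :- r := ρ) refl (ρ t) ε) ε>0

    θ-wellApproximable : WellApproximable ρ θ
    θ-wellApproximable =
      (+ 1 / 8 , ℚ.positive⁻¹ (+ 1 / 8) , 0 , λ n _ → <-≤-trans
        (from-yes (0ℚ + + 1 / 8 ℚ.<? + 1 / 4)) (proj₁ (I-⊑ {0} {n} ℕ.z≤n))) ,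
      (+ 1 / 8 , ℚ.positive⁻¹ (+ 1 / 8) , 0 , λ n _ → ≤-<-trans
        (ℚ.+-monoˡ-≤ (+ 1 / 8) (lo≤hi {0} {n} ℕ.z≤n))
        (from-yes (+ 3 / 4 + + 1 / 8 ℚ.<? 1ℚ))) ,
      θ-irrational , λ T → stage (refinement T) , k≤stage (refinement T) , θ-near T

  WellApproximable-uncountable : Uncountable (WellApproximable ρ)
  WellApproximable-uncountable (f , covers) =
    let k , f≈θ = covers θ θ-wellApproximable in θ≉f k (≈-sym {f k} {θ} f≈θ)
    where open Nested f

-- Powers of α and failure of uniform distribution

∣p*q∣≤ : ∀ {p q a b} → ℚ.∣ p ∣ ≤ a → ℚ.∣ q ∣ ≤ b → ℚ.∣ p * q ∣ ≤ a * b
∣p*q∣≤ {p} {q} {a} {b} p≤a q≤b = begin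
  ℚ.∣ p * q ∣          ≡⟨ ℚ.∣p*q∣≡∣p∣*∣q∣ p q ⟩
  ℚ.∣ p ∣ * ℚ.∣ q ∣    ≤⟨ *-monoʳ (ℚ.0≤∣p∣ p) q≤b ⟩
  ℚ.∣ p ∣ * b          ≤⟨ ℚ.*-monoʳ-≤-nonNeg b {{ℚ.nonNegative (≤-trans (ℚ.0≤∣p∣ q) q≤b)}} p≤a ⟩
  a * b                ∎
  where open ℚ.≤-Reasoning

^-+ : ∀ α n j k → seq (α ^ℝ (j ℕ.+ k)) n ≡ seq (α ^ℝ j) n * seq (α ^ℝ k) n
^-+ α n zero    k = sym (ℚ.*-identityˡ (seq (α ^ℝ k) n))
^-+ α n (suc j) k = trans (cong (seq α n *_) (^-+ α n j k))
  (sym (ℚ.*-assoc (seq α n) (seq (α ^ℝ j) n) (seq (α ^ℝ k) n)))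

-- Bernoulli's inequality for the `n`-th rational approximations. With `d = 0` it also bounds all
-- powers below by 1.
bernoulli : ∀ α n {d} → 0ℚ ≤ d → 1ℚ + d ≤ seq α n → ∀ k → 1ℚ + ι k * d ≤ seq (α ^ℝ k) n
bernoulli α n {d} 0≤d 1+d≤α zero    = ℚ.≤-reflexive
  (solve 1 (λ d → con 1ℚ :+ con 0ℚ :* d := con 1ℚ) refl d)
bernoulli α n {d} 0≤d 1+d≤α (suc k) = subst (λ i → 1ℚ + i * d ≤ a * p) (sym (ι-suc k)) (≤-by
  {r = (a - (1ℚ + d)) * p + (1ℚ + d) * (p - (1ℚ + ι k * d)) + ι k * (d * d)}
  (solve 4 (λ a p d k → a :* p :- (con 1ℚ :+ (k :+ con 1ℚ) :* d) :=
      (a :- (con 1ℚ :+ d)) :* p :+ (con 1ℚ :+ d) :* (p :- (con 1ℚ :+ k :* d)) :+ k :* (d :* d))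
    refl a p d (ι k))
  (0≤+ (0≤+ (0≤* (p≤q⇒0≤q-p 1+d≤α) 0≤p) (0≤* (0≤+ (0≤ι 1) 0≤d) (p≤q⇒0≤q-p ih))) (0≤* (0≤ι k)
      (0≤* 0≤d 0≤d))))
  where
  a p : ℚ
  a = seq α n
  p = seq (α ^ℝ k) n
  ih : 1ℚ + ι k * d ≤ p
  ih = bernoulli α n 0≤d 1+d≤α k
  0≤p : 0ℚ ≤ p
  0≤p = ≤-trans (0≤+ (0≤ι 1) (0≤* (0≤ι k) 0≤d)) ih

-- With d = 1/q, the exponent 160q² makes the Bernoulli bound at least 160q;
-- its square 25600q² is 80 times the doubled exponent.
power-beats-exponent : ∀ α → 1ℝ <ℝ α → ∃[ m ] (ℕ.NonZero m ×
  ∃[ N ] (∀ n → N ℕ.≤ n → 1ℚ ≤ seq α n × ι 80 * ι m ≤ seq (α ^ℝ m) n))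
power-beats-exponent α (d , d>0 , N , 1+d<α) =
  k ℕ.+ k , ℕ.>-nonZero (ℕ.s≤s ℕ.z≤n) , N , λ n N≤n →
    ≤-trans (≤-by (solve 1 (λ d → (con 1ℚ :+ d) :- con 1ℚ := d) refl d) (<⇒≤ d>0)) (<⇒≤ (1+d<α n N≤n)) ,
    subst (ι 80 * ι (k ℕ.+ k) ≤_) (sym (^-+ α n k k)) (square n (bernoulli α n (<⇒≤ d>0) (<⇒≤
        (1+d<α n N≤n)) k))
  where
  q₀ q k : ℕ
  q₀ = proj₁ (archimedean d>0 1ℚ)
  q = suc q₀
  k = 160 ℕ.* (q ℕ.* q)
  1≤qd : 1ℚ ≤ ι q * d
  1≤qd = ≤-trans (proj₂ (archimedean d>0 1ℚ))
    (ℚ.*-monoʳ-≤-nonNeg d {{ℚ.nonNegative (<⇒≤ d>0)}} (ι-mono-≤ {q₀} {q} (ℕ.n≤1+n q₀)))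
  ιk : ι k ≡ ι 160 * (ι q * ι q)
  ιk = trans (ι-* 160 (q ℕ.* q)) (cong (λ i → ι 160 * i) (ι-* q q))
  square : ∀ n → 1ℚ + ι k * d ≤ seq (α ^ℝ k) n → ι 80 * ι (k ℕ.+ k) ≤ seq (α ^ℝ k) n * seq (α ^ℝ k) n
  square n bern = begin
    ι 80 * ι (k ℕ.+ k)
        ≡⟨ cong (λ i → ι 80 * i) (trans (ι-+ k k) (cong₂ _+_ ιk ιk)) ⟩
    ι 80 * (ι 160 * (ι q * ι q) + ι 160 * (ι q * ι q))
      ≡⟨ solve 1 (λ q → con (ι 80) :* (con (ι 160) :* (q :* q) :+ con (ι 160) :* (q :* q)) :=
          (con (ι 160) :* q) :* (con (ι 160) :* q)) refl (ι q) ⟩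
    (ι 160 * ι q) * (ι 160 * ι q)          ≤⟨ *-monoʳ 0≤x x≤p ⟩
    (ι 160 * ι q) * p
        ≤⟨ ℚ.*-monoʳ-≤-nonNeg p {{ℚ.nonNegative (≤-trans 0≤x x≤p)}} x≤p ⟩
    p * p                                  ∎
    where
    open ℚ.≤-Reasoning
    p : ℚ
    p = seq (α ^ℝ k) n
    0≤x : 0ℚ ≤ ι 160 * ι q
    0≤x = 0≤* (0≤ι 160) (0≤ι q)
    x≤p : ι 160 * ι q ≤ p
    x≤p = ≤-trans (≤-by {r = ι 160 * (ι q * (ι q * d - 1ℚ)) + 1ℚ}
      (trans (cong (λ i → (1ℚ + i * d) - ι 160 * ι q) ιk)
        (solve 2 (λ q d → (con 1ℚ :+ (con (ι 160) :* (q :* q)) :* d) :- con (ι 160) :* q :=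
          con (ι 160) :* (q :* (q :* d :- con 1ℚ)) :+ con 1ℚ) refl (ι q) d))
      (0≤+ (0≤* (0≤ι 160) (0≤* (0≤ι q) (p≤q⇒0≤q-p 1≤qd))) (0≤ι 1))) bern

-- Naming the integer `z` replaces the floor. The upper bound needs the uniform gap `δ`, since `<ℝ`
-- asks for one; the lower bound, a negated `<ℝ`, needs none.
FracIn-intro : ∀ {β δ} x z → 0ℚ < δ → β ≤ 1ℚ →
  ∃[ N ] (∀ n → N ℕ.≤ n → 0ℚ ≤ seq x n - z / 1 × (seq x n - z / 1) + δ < β) →
  FracIn 0ℝ (fromℚ β) x
FracIn-intro {β} {δ} x z δ>0 β≤1 (N , bounds) =
  x -ℝ fromℤ z ,
  (z , ≈-refl {x -ℝ fromℤ z} , 0≤s , (δ , δ>0 , N , λ n l → <-≤-trans (proj₂ (bounds n l)) β≤1)) ,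
  0≤s , (δ , δ>0 , N , λ n l → proj₂ (bounds n l))
  where
  0≤s : 0ℝ ≤ℝ x -ℝ fromℤ z
  0≤s (η , η>0 , M , s<0) = <⇒≱ (s<0 (N ℕ.+ M) (ℕ.m≤n+m M N))
    (0≤+ (proj₁ (bounds (N ℕ.+ M) (ℕ.m≤m+n N M))) (<⇒≤ η>0))

fromℚ-≤ : ∀ {p q} → p ≤ q → fromℚ p ≤ℝ fromℚ q
fromℚ-≤ {p} {q} p≤q (δ , δ>0 , N , q<p) = <⇒≱ (q<p N ℕ.≤-refl)
  (≤-trans p≤q (≤-by (solve 2 (λ q δ → (q :+ δ) :- q := δ) refl q δ) (<⇒≤ δ>0)))

fromℚ-< : ∀ {p q} → p < q → fromℚ p <ℝ fromℚ q
fromℚ-< {p} {q} p<q = ½ * (q - p) , 0<½* (p<q⇒0<q-p p<q) , 0 , λ _ _ → <-by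
  (solve 2 (λ p q → q :- (p :+ con ½ :* (q :- p)) := con ½ :* (q :- p)) refl p q) (0<½* (p<q⇒0<q-p p<q))

k≤2^k : ∀ k → k ℕ.≤ 2 ℕ.^ k
k≤2^k zero    = ℕ.z≤n
k≤2^k (suc k) = ℕ.+-mono-≤ (ℕ.>-nonZero⁻¹ (2 ℕ.^ k) {{ℕ.m^n≢0 2 k}})
  (ℕ.≤-trans (k≤2^k k) (ℕ.≤-reflexive (sym (ℕ.+-identityʳ (2 ℕ.^ k)))))

-- Only the terms at the multiples m·j with 2ᵗ ≤ j < 2ᵗ⁺¹ are controlled, but
-- up to N = m·2ᵗ⁺¹ they make up the proportion 1/(2m) = 20u > 15u.
biased⇒¬UD : ∀ (x : ℕ → ℝ) m .{{_ : ℕ.NonZero m}} {u} → 0ℚ < u → ι 40 * ι m * u ≡ 1ℚ → ι 15 * u ≤ 1ℚ →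
  (∀ T → ∃[ t ] (T ℕ.≤ t × (∀ j → 2 ℕ.^ t ℕ.≤ j → j ℕ.< 2 ℕ.^ suc t →
    FracIn 0ℝ (fromℚ (ι 15 * u)) (x (m ℕ.* j))))) →
  ¬ UniformlyDistributedMod1 x
biased⇒¬UD x m {{m≢0}} {u} u>0 40mu≡1 15u≤1 blocks ud =
  -- Uniform distribution says something only about hit sets that are given; as the goal is
  -- absurdity, one may be assumed.
  ¬¬-subset N (λ i → FracIn 0ℝ b (x (suc (Fin.toℕ i)))) λ (S , hits) →
    let _ , δ , δ>0 , M , few = proj₂ limit N N₀≤N S hits
    in <⇒≱ (few M ℕ.≤-refl) (too-many S hits δ δ>0)
  where
  b : ℝ
  b = fromℚ (ι 15 * u)
  limit : ∃[ N₀ ] (∀ N → .{{_ : ℕ.NonZero N}} → N₀ ℕ.≤ N → ∀ S → IsHitSet x 0ℝ b N S →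
    ∣ fromℚ (+ Subset.∣ S ∣ / N) -ℝ (b -ℝ 0ℝ) ∣< fromℚ (ι 5 * u))
  -- The tolerance `5u` is the whole excess of the proportion `20u` over the length `15u`; the
  -- strict bound already contradicts it.
  limit = ud 0ℝ b (fromℚ-≤ ℚ.≤-refl) (fromℚ-< (0<* (0<ι 15) u>0)) (fromℚ-≤ 15u≤1)
    (fromℚ (ι 5 * u)) (fromℚ-< (0<* (0<ι 5) u>0))
  t N : ℕ
  t = proj₁ (blocks (proj₁ limit))
  N = m ℕ.* 2 ℕ.^ suc t
  instance
    2^t≢0 : ℕ.NonZero (2 ℕ.^ t)
    2^t≢0 = ℕ.m^n≢0 2 t
    2^1+t≢0 : ℕ.NonZero (2 ℕ.^ suc t)
    2^1+t≢0 = ℕ.m^n≢0 2 (suc t)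
    N≢0 : ℕ.NonZero N
    N≢0 = ℕ.m*n≢0 m (2 ℕ.^ suc t)
  N₀≤N : proj₁ limit ℕ.≤ N
  N₀≤N = ℕ.≤-trans (proj₁ (proj₂ (blocks (proj₁ limit)))) (ℕ.≤-trans (ℕ.n≤1+n t)
    (ℕ.≤-trans (k≤2^k (suc t)) (ℕ.m≤n*m (2 ℕ.^ suc t) m)))
  2^1+t≡ : 2 ℕ.^ suc t ≡ 2 ℕ.^ t ℕ.+ 2 ℕ.^ t
  2^1+t≡ = cong (λ k → 2 ℕ.^ t ℕ.+ k) (ℕ.+-identityʳ (2 ℕ.^ t))
  index : Fin (2 ℕ.^ t) → ℕ
  index i = m ℕ.* (2 ℕ.^ t ℕ.+ Fin.toℕ i)
  in-block : ∀ i → 2 ℕ.^ t ℕ.+ Fin.toℕ i ℕ.< 2 ℕ.^ suc t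
  in-block i = subst (2 ℕ.^ t ℕ.+ Fin.toℕ i ℕ.<_) (sym 2^1+t≡) (ℕ.+-monoʳ-< (2 ℕ.^ t) (Fin.toℕ<n i))
  suc-pred-index : ∀ i → suc (ℕ.pred (index i)) ≡ index i
  suc-pred-index i = ℕ.suc-pred (index i)
    {{ℕ.m*n≢0 m (2 ℕ.^ t ℕ.+ Fin.toℕ i) {{m≢0}}
        {{ℕ.>-nonZero (ℕ.≤-trans (ℕ.>-nonZero⁻¹ (2 ℕ.^ t)) (ℕ.m≤m+n (2 ℕ.^ t) (Fin.toℕ i)))}}}}
  pred-index<N : ∀ i → ℕ.pred (index i) ℕ.< N
  pred-index<N i = subst (ℕ._≤ N) (sym (suc-pred-index i)) (ℕ.*-monoʳ-≤ m (ℕ.<⇒≤ (in-block i)))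
  -- An element `i` of `Fin N` stands for the index `toℕ i + 1`, hence the predecessor.
  position : Fin (2 ℕ.^ t) → Fin N
  position i = Fin.fromℕ< (pred-index<N i)
  suc-position : ∀ i → suc (Fin.toℕ (position i)) ≡ index i
  suc-position i = trans (cong suc (Fin.toℕ-fromℕ< (pred-index<N i))) (suc-pred-index i)
  position-injective : Injective _≡_ _≡_ position
  position-injective {i} {j} e = Fin.toℕ-injective (ℕ.+-cancelˡ-≡ (2 ℕ.^ t) _ _ (ℕ.*-cancelˡ-≡ _ _ m
    (trans (sym (suc-position i)) (trans (cong (suc ∘ Fin.toℕ) e) (suc-position j)))))
  2^t≤∣S∣ : ∀ S → IsHitSet x 0ℝ b N S → 2 ℕ.^ t ℕ.≤ Subset.∣ S ∣
  2^t≤∣S∣ S hits = injective⇒≤∣∣ (2 ℕ.^ t) position position-injective λ i →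
    Equivalence.from (hits (position i)) (subst (FracIn 0ℝ b ∘ x) (sym (suc-position i))
      (proj₂ (proj₂ (blocks (proj₁ limit))) (2 ℕ.^ t ℕ.+ Fin.toℕ i) (ℕ.m≤m+n (2 ℕ.^ t) (Fin.toℕ i))
          (in-block i)))
  20uN≡2^t : ι 20 * u * ι N ≡ ι (2 ℕ.^ t)
  20uN≡2^t = begin
    ι 20 * u * ι N
        ≡⟨ cong (λ i → ι 20 * u * i)
        (trans (ι-* m (2 ℕ.^ suc t)) (cong (λ i → ι m * i) (ι-* 2 (2 ℕ.^ t)))) ⟩
    ι 20 * u * (ι m * (ι 2 * ι (2 ℕ.^ t)))
        ≡⟨ solve 3 (λ u m p → con (ι 20) :* u :* (m :* (con (ι 2) :* p)) :=
        (con (ι 40) :* m :* u) :* p) refl u (ι m) (ι (2 ℕ.^ t)) ⟩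
    (ι 40 * ι m * u) * ι (2 ℕ.^ t)        ≡⟨ cong (_* ι (2 ℕ.^ t)) 40mu≡1 ⟩
    1ℚ * ι (2 ℕ.^ t)                      ≡⟨ ℚ.*-identityˡ (ι (2 ℕ.^ t)) ⟩
    ι (2 ℕ.^ t)                           ∎
    where open ≡-Reasoning
  20u≤∣S∣/N : ∀ S → IsHitSet x 0ℝ b N S → ι 20 * u ≤ + Subset.∣ S ∣ / N
  20u≤∣S∣/N S hits = ℚ.*-cancelʳ-≤-pos (ι N) {{ℚ.positive (0<ι N)}}
    (subst₂ _≤_ (sym 20uN≡2^t) (sym (z/n*n≡z (+ Subset.∣ S ∣) N)) (ι-mono-≤ (2^t≤∣S∣ S hits)))
  too-many : ∀ S → IsHitSet x 0ℝ b N S → ∀ δ → 0ℚ < δ →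
    ι 5 * u ≤ (+ Subset.∣ S ∣ / N - (ι 15 * u - 0ℚ)) + δ
  too-many S hits δ δ>0 = ≤-by {r = (s - ι 20 * u) + δ}
    (solve 3 (λ s u δ → ((s :- (con (ι 15) :* u :- con 0ℚ)) :+ δ) :- con (ι 5) :* u :=
        (s :- con (ι 20) :* u) :+ δ) refl s u δ)
    (0≤+ (p≤q⇒0≤q-p (20u≤∣S∣/N S hits)) (<⇒≤ δ>0))
    where
    s : ℚ
    s = + Subset.∣ S ∣ / N

-- The Cantor set of admissible ξ

module Expansion
  (c : ℕ → ℚ) (D u : ℚ) (1≤c : ∀ j → 1ℚ ≤ c j)
  (c-grows : ∀ j → D * c j ≤ c (suc j))
  (8≤D : ι 8 ≤ D) (Du≡1 : D * u ≡ 1ℚ) (y : ℕ → ℚ) where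

  -- Adding 1 to the floor rounds up; the further 2 separates the two choices
  -- by more than all later steps can make up for.
  digit : Bool → ℤ
  digit false = + 1
  digit true  = + 3

  integerPart : Bool → ℕ → ℚ → ℤ
  integerPart b j x = floor (x * c j - y j) ℤ.+ digit b

  0<c : ∀ j → 0ℚ < c j
  0<c j = <-≤-trans (ℚ.positive⁻¹ 1ℚ) (1≤c j)

  ξ-seq : (ℕ → Bool) → ℕ → ℚ
  ξ-seq b zero    = 1ℚ
  ξ-seq b (suc j) =
    (y (suc j) + integerPart (b j) (suc j) (ξ-seq b j) / 1) * proj₁ (inverse (0<c (suc j)))

  ξ-target : ∀ b j →
    c (suc j) * ξ-seq b (suc j) ≡ y (suc j) + integerPart (b j) (suc j) (ξ-seq b j) / 1
  ξ-target b j = begin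
    c (suc j) * (w * r)  ≡⟨ solve 3 (λ c w r → c :* (w :* r) := (c :* r) :* w) refl (c (suc j)) w r ⟩
    (c (suc j) * r) * w  ≡⟨ cong (_* w) (proj₂ (proj₂ (inverse (0<c (suc j))))) ⟩
    1ℚ * w               ≡⟨ ℚ.*-identityˡ w ⟩
    w                    ∎
    where
    open ≡-Reasoning
    r = proj₁ (inverse (0<c (suc j)))
    w = y (suc j) + integerPart (b j) (suc j) (ξ-seq b j) / 1

  digit-bounds : ∀ b → (1ℚ ≤ digit b / 1) × (digit b / 1 ≤ ι 3)
  digit-bounds false = /1-mono-≤ {+ 1} {+ 1} (ℤ.+≤+ ℕ.≤-refl) , /1-mono-≤ {+ 1} {+ 3} (ℤ.+≤+
      (ℕ.s≤s ℕ.z≤n))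
  digit-bounds true  = /1-mono-≤ {+ 1} {+ 3} (ℤ.+≤+ (ℕ.s≤s ℕ.z≤n)) , ℚ.≤-refl

  -- Rounding `v` up to `floor v + 1` adds more than 0 and at most 1; the digit adds a further 0 or
  -- 2.
  ξ-increment : ∀ b j →
    (0ℚ ≤ c (suc j) * (ξ-seq b (suc j) - ξ-seq b j)) ×
    (c (suc j) * (ξ-seq b (suc j) - ξ-seq b j) ≤ ι 3)
  ξ-increment b j =
    subst (0ℚ ≤_) (sym eq) (0≤+ (<⇒≤ (p<q⇒0<q-p (<-floor v))) (p≤q⇒0≤q-p (proj₁ (digit-bounds
        (b j))))) ,
    subst (_≤ ι 3) (sym eq)
      (≤-by {r = (v - ⌊v⌋) + (ι 3 - d)}
        (solve 4 (λ v f d t → t :- (((f :+ con 1ℚ) :- v) :+ (d :- con 1ℚ)) :=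
            (v :- f) :+ (t :- d)) refl v ⌊v⌋ d (ι 3))
        (0≤+ (p≤q⇒0≤q-p (floor-≤ v)) (p≤q⇒0≤q-p (proj₂ (digit-bounds (b j))))))
    where
    x = ξ-seq b j
    C = c (suc j)
    v = x * C - y (suc j)
    ⌊v⌋ = floor v / 1
    d = digit (b j) / 1
    eq : C * (ξ-seq b (suc j) - x) ≡ ((⌊v⌋ + 1ℚ) - v) + (d - 1ℚ)
    eq = begin
      C * (ξ-seq b (suc j) - x)
        ≡⟨ solve 3 (λ c s x → c :* (s :- x) := c :* s :- c :* x) refl C (ξ-seq b (suc j)) x ⟩
      C * ξ-seq b (suc j) - C * x
        ≡⟨ cong (_- C * x) (trans (ξ-target b j) (cong (λ k → y (suc j) + k) (/1-+ (floor v) (digit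
            (b j))))) ⟩
      (y (suc j) + (⌊v⌋ + d)) - C * x
        ≡⟨ solve 5 (λ y f d c x → (y :+ (f :+ d)) :- c :* x :=
            ((f :+ con 1ℚ) :- (x :* c :- y)) :+ (d :- con 1ℚ))
             refl (y (suc j)) ⌊v⌋ d C x ⟩
      ((⌊v⌋ + 1ℚ) - v) + (d - 1ℚ)  ∎
      where open ≡-Reasoning

  ξ-mono-suc : ∀ b j → ξ-seq b j ≤ ξ-seq b (suc j)
  ξ-mono-suc b j = *-cancelˡ (0<c (suc j)) (≤-by
    (solve 3 (λ c s x → c :* s :- c :* x :=
        c :* (s :- x)) refl (c (suc j)) (ξ-seq b (suc j)) (ξ-seq b j))
    (proj₁ (ξ-increment b j)))

  ξ-mono-+ : ∀ b d j → ξ-seq b j ≤ ξ-seq b (d ℕ.+ j)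
  ξ-mono-+ b zero    j = ℚ.≤-refl
  ξ-mono-+ b (suc d) j = ≤-trans (ξ-mono-+ b d j) (ξ-mono-suc b (d ℕ.+ j))

  ξ-mono : ∀ b {j k} → j ℕ.≤ k → ξ-seq b j ≤ ξ-seq b k
  ξ-mono b {j} {k} j≤k = subst (λ k → ξ-seq b j ≤ ξ-seq b k) (ℕ.m∸n+n≡m j≤k) (ξ-mono-+ b (k ℕ.∸ j) j)

  8c≤c : ∀ j → ι 8 * c j ≤ c (suc j)
  8c≤c j = ≤-trans (ℚ.*-monoʳ-≤-nonNeg (c j) {{ℚ.nonNegative (<⇒≤ (0<c j))}} 8≤D) (c-grows j)

  -- The first increment contributes at most 3. The remaining tail is at most 6 on the scale of the
  -- next `c`, which is at least 8 times larger, so it contributes at most 6/8 here.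
  ξ-tail-+ : ∀ b d j → c (suc j) * (ξ-seq b (d ℕ.+ j) - ξ-seq b j) ≤ ι 6
  ξ-tail-+ b zero    j = subst (_≤ ι 6)
    (solve 2 (λ c x → con 0ℚ := c :* (x :- x)) refl (c (suc j)) (ξ-seq b j)) (0≤ι 6)
  ξ-tail-+ b (suc d) j = ≤-by {r = (ι 3 - C * (s - x)) + ½ * ((ι 6 - C′ * t) +
      (C′ - ι 8 * C) * t + ι 6 * (C * t))}
    (trans (cong (λ e → ι 6 - C * (e - x)) (cong (ξ-seq b) (sym (ℕ.+-suc d j))))
    (solve 5 (λ C C′ z s x → con (ι 6) :- C :* (z :- x) :=
       (con (ι 3) :- C :* (s :- x)) :+ con ½ :* ((con (ι 6) :- C′ :* (z :- s)) :+ (C′ :- con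
           (ι 8) :* C) :* (z :- s) :+ con (ι 6) :* (C :* (z :- s))))
       refl C C′ z s x))
    (0≤+ (p≤q⇒0≤q-p (proj₂ (ξ-increment b j)))
      (0≤* (<⇒≤ (ℚ.positive⁻¹ ½)) (0≤+ (0≤+ (p≤q⇒0≤q-p (ξ-tail-+ b d (suc j)))
        (0≤* (p≤q⇒0≤q-p (8c≤c (suc j))) 0≤t)) (0≤* (0≤ι 6) (0≤* (<⇒≤ (0<c (suc j))) 0≤t)))))
    where
    C = c (suc j)
    C′ = c (suc (suc j))
    z = ξ-seq b (d ℕ.+ suc j)
    s = ξ-seq b (suc j)
    x = ξ-seq b j
    t = z - s
    0≤t : 0ℚ ≤ t
    0≤t = p≤q⇒0≤q-p (ξ-mono-+ b d (suc j))

  ξ-tail : ∀ b {j k} → j ℕ.≤ k → c (suc j) * (ξ-seq b k - ξ-seq b j) ≤ ι 6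
  ξ-tail b {j} {k} j≤k = subst (λ k → c (suc j) * (ξ-seq b k - ξ-seq b j) ≤ ι 6)
    (ℕ.m∸n+n≡m j≤k) (ξ-tail-+ b (k ℕ.∸ j) j)

  0<D : 0ℚ < D
  0<D = <-≤-trans (0<ι 8) 8≤D

  -- Since `c (suc j)` is at least `D` times `c j`, the bound 6 turns into `6 / D = 6u`: the final
  -- error of `c j * ξ` against its target.
  ξ-tail′ : ∀ b {j k} → j ℕ.≤ k → c j * (ξ-seq b k - ξ-seq b j) ≤ ι 6 * u
  ξ-tail′ b {j} {k} j≤k = *-cancelˡ 0<D (≤-by
    {r = (ι 6 - c (suc j) * t) + (c (suc j) - D * c j) * t}
    (trans (cong (_- D * (c j * t)) (trans
        (solve 2 (λ D u → D :* (con (ι 6) :* u) := con (ι 6) :* (D :* u)) refl D u)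
        (cong (ι 6 *_) Du≡1)))
      (solve 4 (λ D c C t → con (ι 6) :* con 1ℚ :- D :* (c :* t) :=
          (con (ι 6) :- C :* t) :+ (C :- D :* c) :* t)
        refl D (c j) (c (suc j)) t))
    (0≤+ (p≤q⇒0≤q-p (ξ-tail b j≤k)) (0≤* (p≤q⇒0≤q-p (c-grows j)) (p≤q⇒0≤q-p (ξ-mono b j≤k)))))
    where
    t = ξ-seq b k - ξ-seq b j

  1≤ξ : ∀ b k → 1ℚ ≤ ξ-seq b k
  1≤ξ b k = ξ-mono b {0} {k} ℕ.z≤n

  -- The total growth is at most `6 / c 1`, and `c 1 ≥ 8`.
  ξ≤2 : ∀ b k → ξ-seq b k ≤ ι 2
  ξ≤2 b k = *-cancelˡ (0<c 1) (≤-by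
    {r = (ι 6 - c 1 * (ξ-seq b k - 1ℚ)) + (c 1 - ι 8 * c 0) + ι 8 * (c 0 - 1ℚ) + ι 2}
    (solve 3 (λ C c x → C :* con (ι 2) :- C :* x :=
      (con (ι 6) :- C :* (x :- con 1ℚ)) :+ (C :- con (ι 8) :* c) :+ con (ι 8) :* (c :- con 1ℚ) :+ con
          (ι 2))
      refl (c 1) (c 0) (ξ-seq b k))
    (0≤+ (0≤+ (0≤+ (p≤q⇒0≤q-p (ξ-tail b {0} {k} ℕ.z≤n)) (p≤q⇒0≤q-p (8c≤c 0)))
      (0≤* (0≤ι 8) (p≤q⇒0≤q-p (1≤c 0)))) (0≤ι 2)))

  ι≤c : ∀ j → ι j ≤ c j
  ι≤c zero    = ≤-trans (0≤ι 1) (1≤c 0)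
  ι≤c (suc j) = subst (_≤ c (suc j)) (sym (ι-suc j)) (≤-by
    {r = (c (suc j) - ι 8 * c j) + (c j - ι j) + ι 6 * c j + (c j - 1ℚ)}
    (solve 3 (λ C c i → C :- (i :+ con 1ℚ) :=
        (C :- con (ι 8) :* c) :+ (c :- i) :+ con (ι 6) :* c :+ (c :- con 1ℚ))
      refl (c (suc j)) (c j) (ι j))
    (0≤+ (0≤+ (0≤+ (p≤q⇒0≤q-p (8c≤c j)) (p≤q⇒0≤q-p (ι≤c j))) (0≤* (0≤ι 6) (<⇒≤ (0<c j)))) (p≤q⇒0≤q-p
        (1≤c j))))

  ξ-cauchy : ∀ b → Cauchy (ξ-seq b)
  ξ-cauchy b ε ε>0 = N , λ m n N≤m N≤n → ∣p∣<
      (subst (_< ε) (solve 2 (λ m n → n :- m :=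
          :- (m :- n)) refl (ξ-seq b m) (ξ-seq b n)) (diff n m N≤n N≤m))
      (diff m n N≤m N≤n)
    where
    N : ℕ
    N = proj₁ (archimedean ε>0 (ι 7))
    7≤Nε : ι 7 ≤ ι N * ε
    7≤Nε = proj₂ (archimedean ε>0 (ι 7))
    diff : ∀ m n → N ℕ.≤ m → N ℕ.≤ n → ξ-seq b m - ξ-seq b n < ε
    diff m n N≤m N≤n = ≤-<-trans
      (ℚ.+-monoʳ-≤ (ξ-seq b m) (ℚ.neg-antimono-≤ (ξ-mono b N≤n)))
      (ℚ.*-cancelˡ-<-nonNeg (ι N) {{ℚ.nonNegative (0≤ι N)}} (begin-strict
        ι N * t        ≤⟨ ℚ.*-monoʳ-≤-nonNeg t {{ℚ.nonNegative (p≤q⇒0≤q-p (ξ-mono b N≤m))}}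
                            (≤-trans (ι-mono-≤ {N} {suc N} (ℕ.n≤1+n N)) (ι≤c (suc N))) ⟩
        c (suc N) * t  ≤⟨ ξ-tail b N≤m ⟩
        ι 6            <⟨ from-yes (ι 6 ℚ.<? ι 7) ⟩
        ι 7            ≤⟨ 7≤Nε ⟩
        ι N * ε        ∎))
      where
      open ℚ.≤-Reasoning
      t = ξ-seq b m - ξ-seq b N

  ξ : (ℕ → Bool) → ℝ
  ξ b = mkℝ (ξ-seq b) (ξ-cauchy b)

  ξ-seq-cong : ∀ {b b′} → b ≗ b′ → ∀ j → ξ-seq b j ≡ ξ-seq b′ j
  ξ-seq-cong b≗b′ zero    = refl
  ξ-seq-cong b≗b′ (suc j) =
    cong₂ (λ β x → (y (suc j) + integerPart β (suc j) x / 1) * proj₁ (inverse (0<c (suc j))))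
      (b≗b′ j) (ξ-seq-cong b≗b′ j)

  -- On the scale `C = c (suc j)` the digits put `b′` ahead by 2. Afterwards `b` gains at most 1 and
  -- `b′` loses nothing, so the limits stay at least 1/C apart.
  ξ-separated : ∀ b b′ j → ξ-seq b j ≡ ξ-seq b′ j → b j ≡ false → b′ j ≡ true → ¬ (ξ b′ ≈ ξ b)
  ξ-separated b b′ j eq bj b′j ξ′≈ξ = ℚ.<-irrefl refl (begin-strict
    1ℚ
        ≤⟨ ≤-by (solve 1 (λ a → (con (ι 2) :- a) :- con 1ℚ :=
        con 1ℚ :- a) refl (C * (z - s))) (p≤q⇒0≤q-p tail≤1) ⟩
    ι 2 - C * (z - s)
        ≡⟨ solve 4 (λ C s′ s z → con (ι 2) :- C :* (z :- s) :=
        (C :* s :+ con (ι 2)) :- C :* z) refl C s′ s z ⟩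
    (C * s + ι 2) - C * z      ≡⟨ cong (_- C * z) gap ⟨
    C * s′ - C * z
        ≤⟨ ℚ.+-monoˡ-≤ (- (C * z)) (*-monoʳ (<⇒≤ (0<c (suc j))) (ξ-mono b′ j<k)) ⟩
    C * z′ - C * z             ≡⟨ solve 3 (λ C z′ z → C :* z′ :- C :* z := C :* (z′ :- z)) refl C z′ z ⟩
    C * (z′ - z)
        <⟨ ℚ.*-monoʳ-<-pos C {{ℚ.positive (0<c (suc j))}} (∣p∣<⇒p< (close k (ℕ.m≤m+n N (suc j)))) ⟩
    C * r                      ≡⟨ proj₂ (proj₂ (inverse (0<c (suc j)))) ⟩
    1ℚ                         ∎)
    where
    open ℚ.≤-Reasoning
    C = c (suc j)
    C′ = c (suc (suc j))
    r = proj₁ (inverse (0<c (suc j)))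
    r>0 : 0ℚ < r
    r>0 = proj₁ (proj₂ (inverse (0<c (suc j))))
    N : ℕ
    N = proj₁ (ξ′≈ξ r r>0)
    close : ∀ n → N ℕ.≤ n → ℚ.∣ ξ-seq b′ n - ξ-seq b n ∣ < r
    close = proj₂ (ξ′≈ξ r r>0)
    k = N ℕ.+ suc j
    j<k : suc j ℕ.≤ k
    j<k = ℕ.m≤n+m (suc j) N
    z = ξ-seq b k
    z′ = ξ-seq b′ k
    s = ξ-seq b (suc j)
    s′ = ξ-seq b′ (suc j)
    tail≤1 : C * (z - s) ≤ 1ℚ
    tail≤1 = *-cancelˡ (0<ι 8) (≤-by
      {r = (ι 6 - C′ * (z - s)) + (C′ - ι 8 * C) * (z - s) + ι 2}
      (solve 3 (λ C C′ t → con (ι 8) :* con 1ℚ :- con (ι 8) :* (C :* t) :=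
          (con (ι 6) :- C′ :* t) :+ (C′ :- con (ι 8) :* C) :* t :+ con (ι 2))
        refl C C′ (z - s))
      (0≤+ (0≤+ (p≤q⇒0≤q-p (ξ-tail b j<k))
        (0≤* (p≤q⇒0≤q-p (8c≤c (suc j))) (p≤q⇒0≤q-p (ξ-mono b j<k)))) (0≤ι 2)))
    target : ∀ b β → b j ≡ β →
      C * ξ-seq b (suc j) ≡ y (suc j) + (floor (ξ-seq b j * C - y (suc j)) / 1 + digit β / 1)
    target b _ refl = trans (ξ-target b j)
      (cong (λ k → y (suc j) + k) (/1-+ (floor (ξ-seq b j * C - y (suc j))) (digit (b j))))
    gap : C * s′ ≡ C * s + ι 2
    gap = trans (target b′ true b′j)
      (trans (cong (λ x → y (suc j) + (floor (x * C - y (suc j)) / 1 + ι 3)) (sym eq))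
      (trans (solve 2 (λ y f → y :+ (f :+ con (ι 3)) := (y :+ (f :+ con (ι 1))) :+ con (ι 2)) refl
               (y (suc j)) (floor (ξ-seq b j * C - y (suc j)) / 1))
        (cong (_+ ι 2) (sym (target b false bj)))))

  -- Joint induction: equal bits before `j` give equal partial values at `j`, and then separation
  -- forces the bits at `j` to agree.
  ξ-injective : ∀ {b b′} → ξ b ≈ ξ b′ → b ≗ b′
  ξ-injective {b} {b′} ξ≈ξ′ = λ j → bits j (agree j)
    where
    bits : ∀ j → ξ-seq b j ≡ ξ-seq b′ j → b j ≡ b′ j
    bits j eq with b j in bj | b′ j in b′j
    ... | false | false = refl
    ... | true  | true  = refl
    ... | false | true  = ⊥-elim (ξ-separated b b′ j eq bj b′j (≈-sym {ξ b} {ξ b′} ξ≈ξ′))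
    ... | true  | false = ⊥-elim (ξ-separated b′ b j (sym eq) b′j bj ξ≈ξ′)
    agree : ∀ j → ξ-seq b j ≡ ξ-seq b′ j
    agree zero    = refl
    agree (suc j) = cong₂ (λ β x → (y (suc j) + integerPart β (suc j) x / 1) * proj₁ (inverse (0<c
        (suc j))))
      (bits j (agree j)) (agree j)

-- The two sets

module Construction (α : ℝ) (m : ℕ) {{m≢0 : ℕ.NonZero m}} (N₀ : ℕ)
  (large : ∀ n → N₀ ℕ.≤ n → 1ℚ ≤ seq α n × ι 80 * ι m ≤ seq (α ^ℝ m) n) where

  power : ℕ → ℕ → ℚ
  power j n = seq (α ^ℝ (m ℕ.* j)) n

  D : ℚ
  D = ι 40 * ι m

  40≤D : ι 40 ≤ D
  40≤D = subst (_≤ D) (ℚ.*-identityʳ (ι 40)) (*-monoʳ (0≤ι 40) (ι-mono-≤ {1} {m} (ℕ.>-nonZero⁻¹ m)))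

  0<D : 0ℚ < D
  0<D = <-≤-trans (0<ι 40) 40≤D

  u : ℚ
  u = proj₁ (inverse 0<D)

  0<u : 0ℚ < u
  0<u = proj₁ (proj₂ (inverse 0<D))

  0≤u : 0ℚ ≤ u
  0≤u = <⇒≤ 0<u

  Du≡1 : D * u ≡ 1ℚ
  Du≡1 = proj₂ (proj₂ (inverse 0<D))

  40u≤1 : ι 40 * u ≤ 1ℚ
  40u≤1 = subst (ι 40 * u ≤_) Du≡1 (ℚ.*-monoʳ-≤-nonNeg u {{ℚ.nonNegative 0≤u}} 40≤D)

  15u≤1 : ι 15 * u ≤ 1ℚ
  15u≤1 = ≤-trans (ℚ.*-monoʳ-≤-nonNeg u
      {{ℚ.nonNegative 0≤u}} (ι-mono-≤ {15} {40} (ℕ.m≤m+n 15 25))) 40u≤1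

  u≤1 : u ≤ 1ℚ
  u≤1 = ≤-trans (≤-by (solve 1 (λ u → con (ι 40) :* u :- u :=
      con (ι 39) :* u) refl u) (0≤* (0≤ι 39) 0≤u)) 40u≤1

  precision : ℕ → ℕ
  precision j = proj₁ (cauchy (α ^ℝ (m ℕ.* j)) u 0<u) ℕ.+ N₀

  N₀≤precision : ∀ j → N₀ ℕ.≤ precision j
  N₀≤precision j = ℕ.m≤n+m N₀ (proj₁ (cauchy (α ^ℝ (m ℕ.* j)) u 0<u))

  c : ℕ → ℚ
  c j = power j (precision j)

  c-close : ∀ j n → precision j ℕ.≤ n → ℚ.∣ power j n - c j ∣ < u
  c-close j n l = proj₂ (cauchy (α ^ℝ (m ℕ.* j)) u 0<u) n (precision j)
    (ℕ.≤-trans (ℕ.m≤m+n M N₀) l) (ℕ.m≤m+n M N₀)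
    where
    M : ℕ
    M = proj₁ (cauchy (α ^ℝ (m ℕ.* j)) u 0<u)

  1≤power : ∀ j n → N₀ ℕ.≤ n → 1ℚ ≤ power j n
  1≤power j n l = ≤-trans
    (ℚ.≤-reflexive (solve 1 (λ k → con 1ℚ := con 1ℚ :+ k :* con 0ℚ) refl (ι (m ℕ.* j))))
    (bernoulli α n ℚ.≤-refl (proj₁ (large n l)) (m ℕ.* j))

  1≤c : ∀ j → 1ℚ ≤ c j
  1≤c j = 1≤power j (precision j) (N₀≤precision j)

  power-suc : ∀ j n → power (suc j) n ≡ seq (α ^ℝ m) n * power j n
  power-suc j n = trans (cong (λ k → seq (α ^ℝ k) n) (ℕ.*-suc m j)) (^-+ α n m (m ℕ.* j))

  -- The spare factor 2 in `2D ≤ α^m` pays for approximating both powers: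
  -- `2D (c j - u) - u = 2D c j - 2 - u`, which is at least `D c j` because `D c j ≥ 40`.
  c-grows : ∀ j → D * c j ≤ c (suc j)
  c-grows j = begin
    D * c j                          ≤⟨ ≤-by {r = D * (c j - 1ℚ) + (D - ι 40) + (1ℚ - u) + ι 37}
      (trans (solve 3 (λ D c u → ((D :+ D) :* (c :- u) :- u) :- D :* c :=
          D :* (c :- con 1ℚ) :+ (D :- con (ι 40)) :+ (con 1ℚ :- u) :+ (con (ι 39) :- con (ι 2) :*
          (D :* u))) refl D (c j) u)
        (cong (λ e → D * (c j - 1ℚ) + (D - ι 40) + (1ℚ - u) + (ι 39 - ι 2 * e)) Du≡1))
      (0≤+ (0≤+ (0≤+ (0≤* (<⇒≤ 0<D) (p≤q⇒0≤q-p (1≤c j))) (p≤q⇒0≤q-p 40≤D)) (p≤q⇒0≤q-p u≤1)) (0≤ι 37)) ⟩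
    (D + D) * (c j - u) - u          ≤⟨ ℚ.+-monoˡ-≤ (- u) (*-monoʳ (0≤+ (<⇒≤ 0<D) (<⇒≤ 0<D))
      (≤-by (solve 3 (λ p c u → p :- (c :- u) := u :- (:- (p :- c))) refl p (c j) u)
        (<⇒≤ (p<q⇒0<q-p (∣p∣<⇒-q< (c-close j n (ℕ.m≤m+n (precision j) (precision (suc j)))))))) ) ⟩
    (D + D) * p - u
        ≡⟨ cong (λ d → d * p - u) (solve 1 (λ m → con (ι 40) :* m :+ con (ι 40) :* m :=
        con (ι 80) :* m) refl (ι m)) ⟩
    ι 80 * ι m * p - u
        ≤⟨ ℚ.+-monoˡ-≤ (- u) (ℚ.*-monoʳ-≤-nonNeg p {{ℚ.nonNegative
        (≤-trans (0≤ι 1) (1≤power j n N₀≤n))}} (proj₂ (large n N₀≤n))) ⟩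
    a * p - u                        ≡⟨ cong (_- u) (power-suc j n) ⟨
    p′ - u
        ≤⟨ ≤-by (solve 3 (λ p c u → c :- (p :- u) := u :- (p :- c)) refl p′ (c (suc j)) u)
      (<⇒≤ (p<q⇒0<q-p (∣p∣<⇒p< (c-close (suc j) n (ℕ.m≤n+m (precision (suc j)) (precision j)))))) ⟩
    c (suc j)                        ∎
    where
    open ℚ.≤-Reasoning
    n : ℕ
    -- A common index at which both powers are within `u` of their approximations.
    n = precision j ℕ.+ precision (suc j)
    N₀≤n : N₀ ℕ.≤ n
    N₀≤n = ℕ.≤-trans (N₀≤precision j) (ℕ.m≤m+n (precision j) (precision (suc j)))
    a p p′ : ℚ
    a = seq (α ^ℝ m) n
    p = power j n
    p′ = power (suc j) n

  -- The shift 4u makes up for the errors of absolute value at most u, u, 2u.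
  y : ℕ → ℚ
  y j = ι (m ℕ.* j) * rational ⌊log₂ j ⌋ + ι 4 * u

  open Expansion c D u 1≤c c-grows (≤-trans (ι-mono-≤ {8} {40} (ℕ.m≤m+n 8 32)) 40≤D) Du≡1 y public
    using (ξ; ξ-seq; ξ-seq-cong; ξ-injective; ξ-target; integerPart; 0<c; 1≤ξ; ξ≤2; ξ-mono; ξ-tail′)

  blockEnd : ℕ → ℚ
  blockEnd t = ι (m ℕ.* 2 ℕ.^ suc t)

  0<blockEnd : ∀ t → 0ℚ < blockEnd t
  0<blockEnd t = 0<ι (m ℕ.* 2 ℕ.^ suc t) {{ℕ.m*n≢0 m (2 ℕ.^ suc t) {{m≢0}} {{ℕ.m^n≢0 2 (suc t)}}}}

  -- Half of `u / blockEnd t`: `Within` is later used with slack `ρ t`, and twice `ρ t` times any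
  -- index up to the block end is at most `u`.
  ρ : ℕ → ℚ
  ρ t = ½ * u * proj₁ (inverse (0<blockEnd t))

  0<ρ : ∀ t → 0ℚ < ρ t
  0<ρ t = 0<* (0<½* 0<u) (proj₁ (proj₂ (inverse (0<blockEnd t))))

  blockEnd*ρ : ∀ t → blockEnd t * ρ t ≡ ½ * u
  blockEnd*ρ t = begin
    e * (½ * u * r)    ≡⟨ solve 3 (λ e u r → e :* (con ½ :* u :* r) :=
        con ½ :* u :* (e :* r)) refl e u r ⟩
    ½ * u * (e * r)    ≡⟨ cong (λ k → ½ * u * k) (proj₂ (proj₂ (inverse (0<blockEnd t)))) ⟩
    ½ * u * 1ℚ         ≡⟨ ℚ.*-identityʳ (½ * u) ⟩
    ½ * u              ∎
    where
    open ≡-Reasoning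
    e r : ℚ
    e = blockEnd t
    r = proj₁ (inverse (0<blockEnd t))

  tρ≤1 : ∀ t → ι t * ρ t ≤ 1ℚ
  tρ≤1 t = begin
    ι t * ρ t         ≤⟨ ℚ.*-monoʳ-≤-nonNeg (ρ t)
        {{ℚ.nonNegative (<⇒≤ (0<ρ t))}} (ι-mono-≤ {t} {m ℕ.* 2 ℕ.^ suc t}
                           (ℕ.≤-trans (ℕ.n≤1+n t) (ℕ.≤-trans (k≤2^k (suc t)) (ℕ.m≤n*m
                               (2 ℕ.^ suc t) m)))) ⟩
    blockEnd t * ρ t  ≡⟨ blockEnd*ρ t ⟩
    ½ * u             ≤⟨ ≤-by {r = (1ℚ - u) + ½ * u} (solve 1 (λ u → con 1ℚ :- con ½ :* u :=
        (con 1ℚ :- u) :+ con ½ :* u) refl u)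
                           (0≤+ (p≤q⇒0≤q-p u≤1) (<⇒≤ (0<½* 0<u))) ⟩
    1ℚ                ∎
    where open ℚ.≤-Reasoning

  C : Pred ℝ 0ℓ
  C = WellApproximable ρ

  Ξ : Pred ℝ 0ℓ
  Ξ x = ∃[ b ] (x ≈ ξ b)

  -- Four errors surround the shift `4u`: replacing `x` by `ξ b` (at most `u`), the power by `c j`
  -- (`2u`, as `ξ ≤ 2`), the limit by its `j`-th term (between 0 and `6u`), and `θ` by `rational t`
  -- (`u`). The sum lies between 0 and `14u`.
  block-hit : ∀ b x → x ≈ ξ b → ∀ θ t → Within (rational t) (ρ t) θ →
    ∀ j → 2 ℕ.^ t ℕ.≤ j → j ℕ.< 2 ℕ.^ suc t →
    FracIn 0ℝ (fromℚ (ι 15 * u)) (x *ℝ α ^ℝ (m ℕ.* j) -ℝ fromℕ (m ℕ.* j) *ℝ θ)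
  block-hit b x x≈ξ θ t near zero    2^t≤j _ = ⊥-elim (ℕ.n≮0 (ℕ.≤-trans (ℕ.>-nonZero⁻¹ (2 ℕ.^ t)
      {{ℕ.m^n≢0 2 t}}) 2^t≤j))
  block-hit b x x≈ξ θ t near j@(suc i) 2^t≤j j<2^1+t =
    FracIn-intro {δ = ½ * u} (x *ℝ α ^ℝ (m ℕ.* j) -ℝ fromℕ (m ℕ.* j) *ℝ θ) Z (0<½* 0<u) 15u≤1
      (M ℕ.+ (K ℕ.+ (precision j ℕ.+ j)) , bounds)
    where
    Z : ℤ
    Z = integerPart (b i) j (ξ-seq b i)
    r n C⁻¹ : ℚ
    r = rational t
    n = ι (m ℕ.* j)
    -- The power is at most `c j + 1`, so `x` must agree with `ξ b` up to `u / (c j + 1)`.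
    0<c+1 : 0ℚ < c j + 1ℚ
    0<c+1 = 0<+ (0<c j) (0≤ι 1)
    C⁻¹ = proj₁ (inverse 0<c+1)
    0<uC⁻¹ : 0ℚ < u * C⁻¹
    0<uC⁻¹ = 0<* 0<u (proj₁ (proj₂ (inverse 0<c+1)))
    M K : ℕ
    M = proj₁ (x≈ξ (u * C⁻¹) 0<uC⁻¹)
    K = proj₁ (near (ρ t) (0<ρ t))
    target : c j * ξ-seq b j ≡ (n * r + ι 4 * u) + Z / 1
    target = trans (ξ-target b i)
      (cong (λ t → (n * rational t + ι 4 * u) + Z / 1) (⌊log₂⌋-unique t 2^t≤j j<2^1+t))
    module _ (k : ℕ) (l : M ℕ.+ (K ℕ.+ (precision j ℕ.+ j)) ℕ.≤ k) where
      M≤k : M ℕ.≤ k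
      M≤k = ℕ.m+n≤o⇒m≤o M l
      K≤k : K ℕ.≤ k
      K≤k = ℕ.m+n≤o⇒m≤o K (ℕ.m+n≤o⇒n≤o M l)
      precision≤k : precision j ℕ.≤ k
      precision≤k = ℕ.m+n≤o⇒m≤o (precision j) (ℕ.m+n≤o⇒n≤o K (ℕ.m+n≤o⇒n≤o M l))
      j≤k : j ℕ.≤ k
      j≤k = ℕ.m+n≤o⇒n≤o (precision j) (ℕ.m+n≤o⇒n≤o K (ℕ.m+n≤o⇒n≤o M l))
      A X Y Θ e₁ e₂ e₃ e₄ : ℚ
      A = power j k
      X = seq x k
      Y = ξ-seq b k
      Θ = seq θ k
      e₁ = (X - Y) * A
      e₂ = Y * (A - c j)
      e₃ = c j * (Y - ξ-seq b j)
      e₄ = n * (Θ - r)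
      decomposition : (X * A - n * Θ) - Z / 1 ≡ e₁ + e₂ + e₃ - e₄ + ι 4 * u
      decomposition = begin
        (X * A - n * Θ) - Z / 1
          ≡⟨ solve 9 (λ X Y A C ξj n Θ r w → (X :* A :- n :* Θ) :- w :=
               ((X :- Y) :* A :+ Y :* (A :- C) :+ C :* (Y :- ξj) :- n :* (Θ :- r)) :+
                   (C :* ξj :- n :* r :- w))
               refl X Y A (c j) (ξ-seq b j) n Θ r (Z / 1) ⟩
        (e₁ + e₂ + e₃ - e₄) + (c j * ξ-seq b j - n * r - Z / 1)
          ≡⟨ cong (λ v → (e₁ + e₂ + e₃ - e₄) + (v - n * r - Z / 1)) target ⟩
        (e₁ + e₂ + e₃ - e₄) + (((n * r + ι 4 * u) + Z / 1) - n * r - Z / 1)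
          ≡⟨ cong (λ v → (e₁ + e₂ + e₃ - e₄) + v)
               (solve 3 (λ p q w → ((p :+ q) :+ w) :- p :- w := q) refl (n * r) (ι 4 * u) (Z / 1)) ⟩
        e₁ + e₂ + e₃ - e₄ + ι 4 * u  ∎
        where open ≡-Reasoning
      ∣A-c∣<u : ℚ.∣ A - c j ∣ < u
      ∣A-c∣<u = c-close j k precision≤k
      0≤A : 0ℚ ≤ A
      0≤A = ≤-trans (0≤ι 1) (1≤power j k (ℕ.≤-trans (N₀≤precision j) precision≤k))
      A≤c+1 : A ≤ c j + 1ℚ
      A≤c+1 = ≤-by {r = (u - (A - c j)) + (1ℚ - u)}
        (solve 3 (λ A c u → (c :+ con 1ℚ) :- A := (u :- (A :- c)) :+ (con 1ℚ :- u)) refl A (c j) u)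
        (0≤+ (<⇒≤ (p<q⇒0<q-p (∣p∣<⇒p< ∣A-c∣<u))) (p≤q⇒0≤q-p u≤1))
      ∣e₁∣≤u : ℚ.∣ e₁ ∣ ≤ u
      ∣e₁∣≤u = subst (ℚ.∣ e₁ ∣ ≤_)
        (trans (solve 3 (λ u r c → u :* r :* c := u :* (c :* r)) refl u C⁻¹ (c j + 1ℚ))
          (trans (cong (u *_) (proj₂ (proj₂ (inverse 0<c+1)))) (ℚ.*-identityʳ u)))
        (∣p*q∣≤ {X - Y} {A} (<⇒≤ (proj₂ (x≈ξ (u * C⁻¹) 0<uC⁻¹) k M≤k))
          (subst (_≤ c j + 1ℚ) (sym (ℚ.0≤p⇒∣p∣≡p 0≤A)) A≤c+1))
      ∣e₂∣≤2u : ℚ.∣ e₂ ∣ ≤ ι 2 * u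
      ∣e₂∣≤2u = ∣p*q∣≤ {Y} {A - c j}
        (subst (_≤ ι 2) (sym (ℚ.0≤p⇒∣p∣≡p (≤-trans (0≤ι 1) (1≤ξ b k)))) (ξ≤2 b k)) (<⇒≤ ∣A-c∣<u)
      0≤e₃ : 0ℚ ≤ e₃
      0≤e₃ = 0≤* (<⇒≤ (0<c j)) (p≤q⇒0≤q-p (ξ-mono b j≤k))
      e₃≤6u : e₃ ≤ ι 6 * u
      e₃≤6u = ξ-tail′ b j≤k
      ∣e₄∣≤u : ℚ.∣ e₄ ∣ ≤ u
      ∣e₄∣≤u = subst (ℚ.∣ e₄ ∣ ≤_)
        (trans (solve 2 (λ e ρ → e :* (ρ :+ ρ) := con (ι 2) :* (e :* ρ)) refl (blockEnd t) (ρ t))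
          (trans (cong (λ v → ι 2 * v) (blockEnd*ρ t)) (solve 1 (λ u → con (ι 2) :* (con ½ :* u) :=
              u) refl u)))
        (∣p*q∣≤ {n} {Θ - r}
          (subst (_≤ blockEnd t) (sym (ℚ.0≤p⇒∣p∣≡p (0≤ι (m ℕ.* j))))
              (ι-mono-≤ {m ℕ.* j} {m ℕ.* 2 ℕ.^ suc t} (ℕ.*-monoʳ-≤ m (ℕ.<⇒≤ j<2^1+t))))
          (<⇒≤ (proj₂ (near (ρ t) (0<ρ t)) k K≤k)))
      0≤q+p : ∀ {p q} → ℚ.∣ p ∣ ≤ q → 0ℚ ≤ q + p
      0≤q+p {p} {q} h = subst (0ℚ ≤_) (solve 2 (λ p q → q :- (:- p) := q :+ p) refl p q)
        (p≤q⇒0≤q-p (≤-trans (p≤∣p∣ (- p)) (subst (_≤ q) (sym (ℚ.∣-p∣≡∣p∣ p)) h)))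
      0≤q-p : ∀ {p q} → ℚ.∣ p ∣ ≤ q → 0ℚ ≤ q - p
      0≤q-p {p} h = p≤q⇒0≤q-p (≤-trans (p≤∣p∣ p) h)
      bounds : 0ℚ ≤ (X * A - n * Θ) - Z / 1 × ((X * A - n * Θ) - Z / 1) + ½ * u < ι 15 * u
      bounds = subst (λ v → 0ℚ ≤ v × v + ½ * u < ι 15 * u) (sym decomposition)
        ( subst (0ℚ ≤_)
            (solve 5 (λ e₁ e₂ e₃ e₄ u → (u :+ e₁) :+ (con (ι 2) :* u :+ e₂) :+ e₃ :+ (u :- e₄) :=
              e₁ :+ e₂ :+ e₃ :- e₄ :+ con (ι 4) :* u) refl e₁ e₂ e₃ e₄ u)
            (0≤+ (0≤+ (0≤+ (0≤q+p {e₁} ∣e₁∣≤u) (0≤q+p {e₂} ∣e₂∣≤2u)) 0≤e₃) (0≤q-p {e₄} ∣e₄∣≤u))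
        , <-by {r = ½ * u + ((u - e₁) + (ι 2 * u - e₂) + (ι 6 * u - e₃) + (u + e₄))}
            (solve 5 (λ e₁ e₂ e₃ e₄ u → con (ι 15) :* u :- (e₁ :+ e₂ :+ e₃ :- e₄ :+ con
                (ι 4) :* u :+ con ½ :* u) :=
              con ½ :* u :+ ((u :- e₁) :+ (con (ι 2) :* u :- e₂) :+ (con (ι 6) :* u :- e₃) :+
                  (u :+ e₄))) refl e₁ e₂ e₃ e₄ u)
            (0<+ (0<½* 0<u) (0≤+ (0≤+ (0≤+ (0≤q-p {e₁} ∣e₁∣≤u) (0≤q-p {e₂} ∣e₂∣≤2u)) (p≤q⇒0≤q-p e₃≤6u))
                (0≤q+p {e₄} ∣e₄∣≤u))) )

  C⊆sp : ∀ x → Ξ x → C ⊆ sp (λ n → x *ℝ α ^ℝ n)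
  C⊆sp x (b , x≈ξ) {θ} (0<θ , θ<1 , irrational , near) = 0<θ , θ<1 , irrational ,
    biased⇒¬UD (λ n → x *ℝ α ^ℝ n -ℝ fromℕ n *ℝ θ) m 0<u Du≡1 15u≤1 λ T →
      let t , T≤t , near-t = near T in t , T≤t , block-hit b x x≈ξ θ t near-t

  Ξ-resp-≈ : Ξ Respects _≈_
  Ξ-resp-≈ {x} {x′} x≈x′ (b , x≈ξ) = b , ≈-trans {x′} {x} {ξ b} (≈-sym {x} {x′} x≈x′) x≈ξ

  Ξ-positive : ∀ x → Ξ x → 0ℝ <ℝ x
  Ξ-positive x (b , x≈ξ) = <ℝ-≈-trans {0ℝ} {ξ b} {x}
    (½ , ℚ.positive⁻¹ ½ , 0 , λ n _ → <-≤-trans (from-yes (0ℚ + ½ ℚ.<? 1ℚ)) (1≤ξ b n))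
    (≈-sym {x} {ξ b} x≈ξ)

  Ξ-cardinality : HasCardinality2^ℵ₀ Ξ
  Ξ-cardinality = record
    { to        = λ b → ξ b , b , ≈-refl {ξ b}
    ; cong      = ξ-cong
    ; bijective = (λ {b} {b′} → ξ-injective {b} {b′}) ,
        λ (x , b , x≈ξ) → b , λ {b′} b′≗b → ≈-trans {ξ b′} {ξ b} {x} (ξ-cong b′≗b) (≈-sym {x} {ξ b} x≈ξ)
    }
    where
    ξ-cong : ∀ {b b′} → b ≗ b′ → ξ b ≈ ξ b′
    ξ-cong {b} {b′} b≗b′ ε ε>0 = 0 , λ n _ → subst (_< ε)
      (sym (trans (cong (λ p → ℚ.∣ p - ξ-seq b′ n ∣) (ξ-seq-cong b≗b′ n)) (cong ℚ.∣_∣ (ℚ.+-inverseʳ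
          (ξ-seq b′ n))))) ε>0

  C-uncountable : Uncountable C
  C-uncountable = WellApproximable-uncountable ρ 0<ρ tρ≤1

theorem1p1 : (∀ (α : ℝ) → 1ℝ <ℝ α →
    Σ[ C ∈ Pred ℝ 0ℓ ] Σ[ Ξ ∈ Pred ℝ 0ℓ ]
    ( C Respects _≈_
    × Ξ Respects _≈_
    × (∀ θ → C θ → 0ℝ <ℝ θ × θ <ℝ 1ℝ × Irrational θ)
    × Uncountable C
    × (∀ ξ → Ξ ξ → 0ℝ <ℝ ξ)
    × HasCardinality2^ℵ₀ Ξ
    × (∀ ξ → Ξ ξ → C ⊆ sp (λ n → ξ *ℝ α ^ℝ n))
    × (∀ ξ → Ξ ξ → Uncountable (sp (λ n → ξ *ℝ α ^ℝ n)))))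
    × ¬ (∀ (ξ α : ℝ) → ¬ (ξ ≈ 0ℝ) → 1ℝ <ℝ α → AtMostCountable (sp (λ n → ξ *ℝ α ^ℝ n)))
theorem1p1 = uncountable-spectra , not-all-countable
  where
  Uncountable-⊆ : ∀ {P Q : Pred ℝ 0ℓ} → P ⊆ Q → Uncountable P → Uncountable Q
  Uncountable-⊆ P⊆Q uncountable (f , covers) = uncountable (f , λ x Px → covers x (P⊆Q Px))

  uncountable-spectra : ∀ α → 1ℝ <ℝ α → _
  uncountable-spectra α 1<α =
    let m , m≢0 , N₀ , large = power-beats-exponent α 1<α
        open Construction α m {{m≢0}} N₀ large
    in C , Ξ , (λ {x} {y} → WellApproximable-resp-≈ ρ {x} {y}) , (λ {x} {y} → Ξ-resp-≈ {x} {y}) ,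
       (λ θ (0<θ , θ<1 , irrational , _) → 0<θ , θ<1 , irrational) ,
       C-uncountable , Ξ-positive , Ξ-cardinality , (λ ξ Ξξ {θ} → C⊆sp ξ Ξξ {θ}) ,
       λ ξ Ξξ → Uncountable-⊆ {C} {sp (λ n → ξ *ℝ α ^ℝ n)} (λ {θ} → C⊆sp ξ Ξξ {θ}) C-uncountable

  2ℝ : ℝ
  2ℝ = fromℕ 2

  not-all-countable : ¬ (∀ (ξ α : ℝ) → ¬ (ξ ≈ 0ℝ) → 1ℝ <ℝ α → AtMostCountable (sp (λ n → ξ *ℝ α ^ℝ n)))
  not-all-countable countable =
    let 1<2 = fromℚ-< {1ℚ} {ι 2} (from-yes (1ℚ ℚ.<? ι 2))
        _ , _ , _ , _ , _ , _ , positive , cardinality , _ , uncountable = uncountable-spectra 2ℝ 1<2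
        -- Any element of the set refutes countability; the constant bit sequence supplies one.
        ξ , Ξξ = Bijection.to cardinality (λ _ → false)
    in uncountable ξ Ξξ (countable ξ 2ℝ (λ ξ≈0 → fromℚ-≤ ℚ.≤-refl (<ℝ-≈-trans {0ℝ} {ξ} {0ℝ}
        (positive ξ Ξξ) ξ≈0)) 1<2)
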